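{- Let $q$ be an odd prime power and $d\ge0$. Let $(\mathbb F_q^{2d},\omega)$ be a symplectic space and let $(\mathbb F_q^{2d+1},Q)$ be a non-degenerate quadratic space of dimension $2d+1$ admitting a $d$-dimensional totally isotropic subspace. Then $$\sum_{F\in\mathcal{WF}(\mathbb F_q^{2d},\omega)}t^{w(F)}=\sum_{F\in\mathcal{WF}(\mathbb F_q^{2d+1},Q)}t^{w(F)}.$$
   Context: For a space $V$ with a non-degenerate symmetric or alternating bilinear form, a subspace is isotropic if the form vanishes identically on it (for the quadratic space, with respect to the associated symmetric bilinear form, equivalently $Q$ vanishes on it since the characteristic is odd). A flag of such a space is a strictly increasing sequence $V_1\subset\dots\subset V_k$ ($k\ge0$) of nonzero isotropic subspaces; a weighted flag additionally carries strictly positive integers $w_1,\dots,w_k$, with weight $w(F)=\sum_i w_i\dim V_i$. $\mathcal{WF}(\cdot)$ denotes the set of weighted flags. -}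

module Defs where

open import Level using (0ℓ)
open import Data.Bool using (Bool; true; false; _∧_; _∨_; not; T; if_then_else_)
open import Data.Nat using (ℕ; zero; suc; _⊔_; _≡ᵇ_; _≤ᵇ_) renaming (_+_ to _+ℕ_; _*_ to _*ℕ_)
open import Data.List using (List; []; _∷_; map; concatMap; foldr; length; sum; upTo)
open import Data.Bool.ListAction using (all; any)
open import Data.List.Relation.Unary.Unique.Propositional using (Unique)
open import Data.List.Membership.Propositional using (_∈_)
open import Data.Product using (Σ; ∃; _×_; _,_)
open import Data.Vec as V using (Vec; []; _∷_; zipWith; replicate; toList)
import Data.Vec.Properties as VP
open import Relation.Nullary using (¬_)
open import Relation.Nullary.Decidable using (⌊_⌋)
open import Relation.Binary.Definitions using (DecidableEquality)
open import Relation.Binary.PropositionalEquality using (_≡_)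
open import Algebra.Structures using (IsCommutativeRing)

record FiniteField : Set₁ where
  field
    Carrier : Set
    _+_ _*_ : Carrier → Carrier → Carrier
    -_      : Carrier → Carrier
    0# 1#   : Carrier
    isCommutativeRing : IsCommutativeRing _≡_ _+_ _*_ -_ 0# 1#
    0≢1     : ¬ (0# ≡ 1#)
    inverse : ∀ x → ¬ (x ≡ 0#) → ∃ λ y → x * y ≡ 1#
    _≟_     : DecidableEquality Carrier
    elements          : List Carrier
    elements-unique   : Unique elements
    elements-complete : ∀ x → x ∈ elements

  order : ℕ
  order = length elements

module Over (𝔽 : FiniteField) where
  open FiniteField 𝔽

  Vect : ℕ → Set
  Vect n = Vec Carrier n

  _+ᵥ_ : ∀ {n} → Vect n → Vect n → Vect n
  _+ᵥ_ = zipWith _+_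

  _·ᵥ_ : ∀ {n} → Carrier → Vect n → Vect n
  c ·ᵥ v = V.map (c *_) v

  0ᵥ : ∀ {n} → Vect n
  0ᵥ = replicate _ 0#

  _≡ᶠ_ : Carrier → Carrier → Bool
  x ≡ᶠ y = ⌊ x ≟ y ⌋

  _≡ᵛ_ : ∀ {n} → Vect n → Vect n → Bool
  u ≡ᵛ v = ⌊ VP.≡-dec _≟_ u v ⌋

  tuples : ∀ {A : Set} → List A → (k : ℕ) → List (Vec A k)
  tuples xs zero    = [] ∷ []
  tuples xs (suc k) = concatMap (λ x → map (x ∷_) (tuples xs k)) xs

  allVecs : (n : ℕ) → List (Vect n)
  allVecs n = tuples elements n

  -- a subset of F^n, given canonically by its indicator mask along allVecs n
  record Subset (n : ℕ) : Set where
    constructor mask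
    field bits : Vec Bool (length (allVecs n))
  open Subset public

  select : ∀ {A : Set} → List A → List Bool → List A
  select []       _            = []
  select (x ∷ xs) []           = []
  select (x ∷ xs) (true  ∷ bs) = x ∷ select xs bs
  select (x ∷ xs) (false ∷ bs) = select xs bs

  members : ∀ {n} → Subset n → List (Vect n)
  members {n} S = select (allVecs n) (toList (bits S))

  _∈ˢ_ : ∀ {n} → Vect n → Subset n → Bool
  v ∈ˢ S = any (λ u → u ≡ᵛ v) (members S)

  isSubspace : ∀ {n} → Subset n → Bool
  isSubspace S =
    (0ᵥ ∈ˢ S)
    ∧ all (λ u → all (λ v → (u +ᵥ v) ∈ˢ S) (members S)) (members S)
    ∧ all (λ c → all (λ u → (c ·ᵥ u) ∈ˢ S) (members S)) elements

  _⊆ˢ_ : ∀ {n} → Subset n → Subset n → Bool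
  S ⊆ˢ T = all (λ v → v ∈ˢ T) (members S)

  _⊂ˢ_ : ∀ {n} → Subset n → Subset n → Bool
  S ⊂ˢ T = (S ⊆ˢ T) ∧ not (T ⊆ˢ S)

  isNonzero : ∀ {n} → Subset n → Bool
  isNonzero S = any (λ v → not (v ≡ᵛ 0ᵥ)) (members S)

  lincomb : ∀ {n k} → Vec Carrier k → Vec (Vect n) k → Vect n
  lincomb []       []       = 0ᵥ
  lincomb (c ∷ cs) (v ∷ vs) = (c ·ᵥ v) +ᵥ lincomb cs vs

  linIndep : ∀ {n k} → Vec (Vect n) k → Bool
  linIndep {k = k} vs =
    all (λ cs → not (lincomb cs vs ≡ᵛ 0ᵥ) ∨ (cs ≡ᵛ 0ᵥ)) (allVecs k)

  hasIndep : ∀ {n} → Subset n → ℕ → Bool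
  hasIndep S k = any linIndep (tuples (members S) k)

  -- dimension: the maximal number of linearly independent vectors in S
  -- (any independent family in F^n has at most n members, so the search
  -- over k = 0,…,n is exhaustive)
  dim : ∀ {n} → Subset n → ℕ
  dim {n} S = foldr (λ k acc → if hasIndep S k then k ⊔ acc else acc) 0 (upTo (suc n))

  Form : ℕ → Set
  Form n = Vect n → Vect n → Carrier

  record IsBilinear {n} (B : Form n) : Set where
    field
      addˡ : ∀ u v w → B (u +ᵥ v) w ≡ B u w + B v w
      addʳ : ∀ u v w → B u (v +ᵥ w) ≡ B u v + B u w
      smulˡ : ∀ c u w → B (c ·ᵥ u) w ≡ c * B u w
      smulʳ : ∀ c u w → B u (c ·ᵥ w) ≡ c * B u w

  NonDegenerate : ∀ {n} → Form n → Set
  NonDegenerate B = ∀ v → (∀ w → B v w ≡ 0#) → v ≡ 0ᵥ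

  record IsSymplectic {n} (ω : Form n) : Set where
    field
      bilinear    : IsBilinear ω
      alternating : ∀ v → ω v v ≡ 0#
      nondeg      : NonDegenerate ω

  polar : ∀ {n} → (Vect n → Carrier) → Form n
  polar Q u v = Q (u +ᵥ v) + ((- (Q u)) + (- (Q v)))

  record IsNondegQuadratic {n} (Q : Vect n → Carrier) : Set where
    field
      homogeneous : ∀ c v → Q (c ·ᵥ v) ≡ (c * c) * Q v
      polarBilinear : IsBilinear (polar Q)
      nondeg : NonDegenerate (polar Q)

  isIsotropic : ∀ {n} → Form n → Subset n → Bool
  isIsotropic B S = all (λ u → all (λ v → B u v ≡ᶠ 0#) (members S)) (members S)

  goodSpace : ∀ {n} → Form n → Subset n → Bool
  goodSpace B S = isSubspace S ∧ isIsotropic B S ∧ isNonzero S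

  strictChainFrom : ∀ {n} → Subset n → List (Subset n × ℕ) → Bool
  strictChainFrom S []             = true
  strictChainFrom S ((T , w) ∷ rest) = (S ⊂ˢ T) ∧ strictChainFrom T rest

  strictChain : ∀ {n} → List (Subset n × ℕ) → Bool
  strictChain []             = true
  strictChain ((S , w) ∷ rest) = strictChainFrom S rest

  isWeightedFlag : ∀ {n} → Form n → List (Subset n × ℕ) → Bool
  isWeightedFlag B fl =
    all (λ { (S , w) → goodSpace B S ∧ (1 ≤ᵇ w) }) fl ∧ strictChain fl

  weight : ∀ {n} → List (Subset n × ℕ) → ℕ
  weight fl = sum (map (λ { (S , w) → w *ℕ dim S }) fl)

  -- weighted flags of (F^n, B) of weight m (the coefficient of t^m)
  WF : ∀ {n} → Form n → ℕ → Set
  WF {n} B m = Σ (List (Subset n × ℕ)) λ fl → T (isWeightedFlag B fl ∧ (weight fl ≡ᵇ m))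

  HasTotIsotropic : ∀ {n} → (Vect n → Carrier) → ℕ → Set
  HasTotIsotropic {n} Q d =
    Σ (Subset n) λ S → T (isSubspace S ∧ isIsotropic (polar Q) S ∧ (dim S ≡ᵇ d))

{-# OPTIONS --safe #-}

-- Count with sizes only. For a subspace S let N(S) be the number of vectors v ∈ S^⊥ with B(v,v) = 0.
-- For both forms N(S)·∣S∣ = q^(2d) on every isotropic S. In the symplectic case N(S) = ∣S^⊥∣. In the
-- orthogonal case, counting the pairs (m , u) with m ∈ S and u + m singular shows that q·N(S) − ∣S^⊥∣
-- is the same for every isotropic S, namely the value at S = 0; and it vanishes at the given
-- d-dimensional S, outside which S^⊥ has no singular vectors.
--
-- Let e(S,t) be the number of isotropic U ⊇ S with ∣U∣ = t. Counting the pairs (U , v) with v ∈ U ∖ S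
-- gives e(S,t)·(t − ∣S∣) = Σ_v e(S + ⟨v⟩, t), where v runs over the N(S) − ∣S∣ singular vectors of
-- S^⊥ ∖ S. Hence e(S,t) depends only on ∣S∣ and t, and is the same for both forms. Since ∣U∣ = q^(dim U),
-- this gives dimension-preserving bijections between the isotropic subspaces above S and above S′ whenever
-- ∣S∣ = ∣S′∣, and flags are matched one step at a time, starting from S = S′ = 0.
module Submission where

open import Defs
open import Data.Nat using (ℕ; _+_; _*_)
open import Data.Nat.Divisibility using (_∣_)
open import Relation.Nullary using (¬_)
open import Function.Bundles using (_↔_)

open import Algebra.Bundles using (CommutativeRing)
import Algebra.Properties.Ring as RingProperties
open import Data.Bool using (Bool; true; false; _∧_; _∨_; not; T; if_then_else_)
open import Data.Bool.ListAction using (all; any)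
open import Data.Bool.Properties using (T-∧; T?; T-irrelevant) renaming (_≟_ to _≟ᵇ_)
open import Data.Empty using (⊥-elim)
open import Data.Fin using (toℕ)
open import Data.Fin.Properties using (toℕ-injective)
open import Data.List using (List; []; _∷_; _++_; map; concatMap; length; lookup; cartesianProductWith; filter; foldr; upTo)
open import Data.List.Membership.Propositional using (_∈_; find; lose)
open import Data.List.Membership.Propositional.Properties using (∈-map⁺; ∈-filter⁺; ∈-filter⁻; ∈-upTo⁺; ∈-cartesianProductWith⁺; ∈-cartesianProductWith⁻)
open import Data.List.Membership.Propositional.Properties.WithK using (unique∧set⇒bag)
open import Data.List.Properties using (length-map; length-++)
open import Data.List.Relation.Binary.BagAndSetEquality using (∼bag⇒↭)
open import Data.List.Relation.Binary.Permutation.Propositional as ↭ using (_↭_)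
open import Data.List.Relation.Unary.All as All using ([]; _∷_)
open import Data.List.Relation.Unary.All.Properties using (all⁺; all⁻)
open import Data.List.Relation.Unary.AllPairs using ([]; _∷_)
open import Data.List.Relation.Unary.Any using (here; there; index)
open import Data.List.Relation.Unary.Any.Properties using (any⁺; any⁻; lookup-index)
open import Data.List.Relation.Unary.Unique.Propositional using (Unique)
import Data.List.Relation.Unary.Unique.Propositional.Properties as Unique
open import Data.Nat using (zero; suc; _∸_; _^_; _⊔_; _≤_; _<_; _≤?_; _≤ᵇ_; _<ᵇ_; _≡ᵇ_; z≤n; s≤s; NonZero; >-nonZero)
open import Data.Nat.Divisibility using (divides)
open import Data.Nat.Properties hiding (_≟_; _≤?_)
open import Data.Nat.Tactic.RingSolver using (solve-∀)
open import Data.Product using (Σ; ∃; _×_; _,_; proj₁; proj₂)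
open import Data.Sum using (_⊎_; inj₁; inj₂)
open import Data.Unit using (⊤)
open import Data.Vec as V using (Vec; []; _∷_; toList; fromList)
import Data.Vec.Properties as VP
open import Data.Vec.Relation.Unary.All as VAll using ([]; _∷_)
open import Function using (_∘_; mk⇔; Equivalence)
open import Function.Bundles using (mk↔ₛ′)
open import Relation.Binary.Definitions using (tri<; tri≈; tri>)
open import Relation.Binary.PropositionalEquality using (_≡_; refl; sym; trans; cong; cong₂; subst; subst₂; module ≡-Reasoning)
open import Relation.Nullary using (yes; no)
open import Relation.Nullary.Decidable using (⌊_⌋; toWitness; fromWitness)

-- Finite sums

-- Linear algebra enters only through cardinalities, and divisions are avoided: an identity is
-- multiplied through by `q`, `q ∸ 1` or a size, and the factor is cancelled at the end. The two
-- geometries meet in one number, the common value `q ^ (2 * d)` of ∣S∣·N(S): it counts all vectors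
-- of the symplectic space and a q-th part of those of the orthogonal space. Odd order makes m ↦
-- 2·B(m,u) a nonzero functional on S whenever u is not orthogonal to S, and the orthogonal count
-- rests on this. On that side everything is phrased with the polar form: B(v,v) = 2·Q(v), so its
-- zeros are those of Q. Subspaces are matched by their positions in two enumerations, so the
-- matching depends on choices. It can still be iterated along a flag, because the next step asks
-- only that the two current subspaces be isotropic and of equal size.

⟦_⟧ : Bool → ℕ
⟦ true ⟧  = 1
⟦ false ⟧ = 0

bool-ext : ∀ {a b} → (T a → T b) → (T b → T a) → a ≡ b
bool-ext {true}  {true}  f g = refl
bool-ext {true}  {false} f g = ⊥-elim (f _)
bool-ext {false} {true}  f g = ⊥-elim (g _)
bool-ext {false} {false} f g = refl

∧⁻ : ∀ {a b} → T (a ∧ b) → T a × T b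
∧⁻ = Equivalence.to T-∧

∧⁺ : ∀ {a b} → T a → T b → T (a ∧ b)
∧⁺ x y = Equivalence.from T-∧ (x , y)

not⁺ : ∀ {a} → ¬ T a → T (not a)
not⁺ {true}  f = f _
not⁺ {false} f = _

not⁻ : ∀ {a} → T (not a) → ¬ T a
not⁻ {false} _ ()

T-dec : ∀ a → T a ⊎ ¬ T a
T-dec true  = inj₁ _
T-dec false = inj₂ λ ()

⟦⟧-true : ∀ {a} → T a → ⟦ a ⟧ ≡ 1
⟦⟧-true {true} _ = refl

⟦⟧-false : ∀ {a} → ¬ T a → ⟦ a ⟧ ≡ 0
⟦⟧-false {true}  f = ⊥-elim (f _)
⟦⟧-false {false} f = refl

⟦⟧-∧ : ∀ a b → ⟦ a ∧ b ⟧ ≡ ⟦ a ⟧ * ⟦ b ⟧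
⟦⟧-∧ true  b = sym (*-identityˡ ⟦ b ⟧)
⟦⟧-∧ false b = refl

⟦⟧-mono : ∀ {a b} → (T a → T b) → ⟦ a ⟧ ≤ ⟦ b ⟧
⟦⟧-mono {true}  {true}  f = ≤-refl
⟦⟧-mono {true}  {false} f = ⊥-elim (f _)
⟦⟧-mono {false}         f = z≤n

⟦⟧-injective : ∀ {a b} → ⟦ a ⟧ ≡ ⟦ b ⟧ → a ≡ b
⟦⟧-injective {true}  {true}  _ = refl
⟦⟧-injective {false} {false} _ = refl

module _ {A : Set} where

  all-∈⁺ : ∀ (p : A → Bool) xs → (∀ x → x ∈ xs → T (p x)) → T (all p xs)
  all-∈⁺ p xs h = all⁻ p (All.tabulate λ {x} → h x)

  all-∈⁻ : ∀ (p : A → Bool) xs → T (all p xs) → ∀ x → x ∈ xs → T (p x)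
  all-∈⁻ p xs h x = All.lookup (all⁺ p xs h)

  any-∈⁺ : ∀ (p : A → Bool) xs x → x ∈ xs → T (p x) → T (any p xs)
  any-∈⁺ p xs x x∈ px = any⁺ p (lose x∈ px)

  any-∈⁻ : ∀ (p : A → Bool) xs → T (any p xs) → ∃ λ x → x ∈ xs × T (p x)
  any-∈⁻ p xs h = find (any⁻ p xs h)

  all-or-counterexample : ∀ (p : A → Bool) xs →
    (∀ x → x ∈ xs → T (p x)) ⊎ ∃ λ x → x ∈ xs × ¬ T (p x)
  all-or-counterexample p xs with T-dec (any (not ∘ p) xs)
  ... | inj₁ h = let x , x∈ , npx = any-∈⁻ (not ∘ p) xs h in inj₂ (x , x∈ , not⁻ npx)
  ... | inj₂ h = inj₁ λ x x∈ → case x x∈ (T-dec (p x))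
    where
    case : ∀ x → x ∈ xs → T (p x) ⊎ ¬ T (p x) → T (p x)
    case x x∈ (inj₁ px)  = px
    case x x∈ (inj₂ npx) = ⊥-elim (h (any-∈⁺ (not ∘ p) xs x x∈ (not⁺ npx)))

  ∑ : List A → (A → ℕ) → ℕ
  ∑ []       f = 0
  ∑ (x ∷ xs) f = f x + ∑ xs f

  ∑-cong-∈ : ∀ xs {f g : A → ℕ} → (∀ x → x ∈ xs → f x ≡ g x) → ∑ xs f ≡ ∑ xs g
  ∑-cong-∈ []       h = refl
  ∑-cong-∈ (x ∷ xs) h = cong₂ _+_ (h x (here refl)) (∑-cong-∈ xs λ y → h y ∘ there)

  ∑-cong : ∀ xs {f g : A → ℕ} → (∀ x → f x ≡ g x) → ∑ xs f ≡ ∑ xs g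
  ∑-cong xs h = ∑-cong-∈ xs λ x _ → h x

  ∑-+ : ∀ xs (f g : A → ℕ) → ∑ xs (λ x → f x + g x) ≡ ∑ xs f + ∑ xs g
  ∑-+ []       f g = refl
  ∑-+ (x ∷ xs) f g rewrite ∑-+ xs f g = lemma (f x) (g x) (∑ xs f) (∑ xs g)
    where
    lemma : ∀ a b c d → a + b + (c + d) ≡ a + c + (b + d)
    lemma = solve-∀

  ∑-*ˡ : ∀ xs c (f : A → ℕ) → ∑ xs (λ x → c * f x) ≡ c * ∑ xs f
  ∑-*ˡ []       c f = sym (*-zeroʳ c)
  ∑-*ˡ (x ∷ xs) c f rewrite ∑-*ˡ xs c f = sym (*-distribˡ-+ c (f x) (∑ xs f))

  ∑-*ʳ : ∀ xs c (f : A → ℕ) → ∑ xs (λ x → f x * c) ≡ ∑ xs f * c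
  ∑-*ʳ []       c f = refl
  ∑-*ʳ (x ∷ xs) c f rewrite ∑-*ʳ xs c f = sym (*-distribʳ-+ c (f x) (∑ xs f))

  ∑-const : ∀ xs c → ∑ xs (λ _ → c) ≡ length xs * c
  ∑-const []       c = refl
  ∑-const (x ∷ xs) c = cong (c +_) (∑-const xs c)

  ∑-zero : ∀ xs {f : A → ℕ} → (∀ x → x ∈ xs → f x ≡ 0) → ∑ xs f ≡ 0
  ∑-zero xs h = trans (∑-cong-∈ xs h) (trans (∑-const xs 0) (*-zeroʳ (length xs)))

  ∑-mono : ∀ xs {f g : A → ℕ} → (∀ x → f x ≤ g x) → ∑ xs f ≤ ∑ xs g
  ∑-mono []       h = z≤n
  ∑-mono (x ∷ xs) h = +-mono-≤ (h x) (∑-mono xs h)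

  -- Equal totals leave no room for a strict inequality at any entry. Through `size-≤⇒⊇` this plays
  -- the part of a dimension comparison for nested subspaces.
  ∑-≤⇒≗ : ∀ xs {f g : A → ℕ} → (∀ x → f x ≤ g x) → ∑ xs g ≤ ∑ xs f →
          ∀ x → x ∈ xs → f x ≡ g x
  ∑-≤⇒≗ (y ∷ xs) {f} {g} h e .y (here refl) =
    ≤-antisym (h y) (+-cancelʳ-≤ (∑ xs f) (g y) (f y) (≤-trans (+-monoʳ-≤ (g y) (∑-mono xs h)) e))
  ∑-≤⇒≗ (y ∷ xs) {f} {g} h e x (there x∈) =
    ∑-≤⇒≗ xs h (+-cancelˡ-≤ (f y) _ _ (≤-trans (+-monoˡ-≤ (∑ xs g) (h y)) e)) x x∈

  ∑-≥ : ∀ {xs x} (f : A → ℕ) → x ∈ xs → f x ≤ ∑ xs f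
  ∑-≥ f (here refl) = m≤m+n _ _
  ∑-≥ f (there x∈)  = ≤-trans (∑-≥ f x∈) (m≤n+m _ _)

  ∑-↭ : ∀ {xs ys} (f : A → ℕ) → xs ↭ ys → ∑ xs f ≡ ∑ ys f
  ∑-↭ f ↭.refl          = refl
  ∑-↭ f (↭.prep x p)    = cong (f x +_) (∑-↭ f p)
  ∑-↭ f (↭.swap x y p) rewrite ∑-↭ f p = lemma (f x) (f y) _
    where
    lemma : ∀ a b c → a + (b + c) ≡ b + (a + c)
    lemma = solve-∀
  ∑-↭ f (↭.trans p r)   = trans (∑-↭ f p) (∑-↭ f r)

  ∑-map : ∀ xs (φ : A → A) (f : A → ℕ) → ∑ (map φ xs) f ≡ ∑ xs (f ∘ φ)
  ∑-map []       φ f = refl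
  ∑-map (x ∷ xs) φ f = cong (f (φ x) +_) (∑-map xs φ f)

  ∑-unique : ∀ {xs a} (p : A → Bool) → Unique xs → a ∈ xs → T (p a) →
             (∀ x → T (p x) → x ≡ a) → ∑ xs (⟦_⟧ ∘ p) ≡ 1
  ∑-unique {x ∷ xs} p (x∉ ∷ u) (here refl) pa h =
    cong₂ _+_ (⟦⟧-true pa) (∑-zero xs λ y y∈ → ⟦⟧-false λ py → All.lookup x∉ y∈ (sym (h y py)))
  ∑-unique {x ∷ xs} p (x∉ ∷ u) (there a∈) pa h =
    cong₂ _+_ (⟦⟧-false λ px → All.lookup x∉ a∈ (h x px)) (∑-unique p u a∈ pa h)

  -- With at most one witness, existence and counting coincide. This turns the search over scalars
  -- in `adjoin` into a sum whose order can be exchanged.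
  ∑-any : ∀ {xs} (p : A → Bool) → Unique xs → (∀ x y → T (p x) → T (p y) → x ≡ y) →
          ⟦ any p xs ⟧ ≡ ∑ xs (⟦_⟧ ∘ p)
  ∑-any {xs} p u h with T-dec (any p xs)
  ... | inj₁ t = let a , a∈ , pa = any-∈⁻ p xs t in
    trans (⟦⟧-true t) (sym (∑-unique p u a∈ pa λ x px → h x a px pa))
  ... | inj₂ f = trans (⟦⟧-false f)
    (sym (∑-zero xs λ x x∈ → ⟦⟧-false λ px → f (any-∈⁺ p xs x x∈ px)))

  ∑-reindex : ∀ {xs} → Unique xs → (∀ x → x ∈ xs) → (φ ψ : A → A) →
              (∀ x → φ (ψ x) ≡ x) → (∀ x → ψ (φ x) ≡ x) → (f : A → ℕ) →
              ∑ xs (f ∘ φ) ≡ ∑ xs f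
  ∑-reindex {xs} u c φ ψ φψ ψφ f = trans (sym (∑-map xs φ f)) (∑-↭ f
    (∼bag⇒↭ (unique∧set⇒bag (Unique.map⁺ inj u) u (λ {x} → mk⇔ (λ _ → c x) (λ _ → subst (_∈ map φ xs) (φψ x) (∈-map⁺ φ (c (ψ x))))))))
    where
    inj : ∀ {x y} → φ x ≡ φ y → x ≡ y
    inj {x} {y} e = trans (sym (ψφ x)) (trans (cong ψ e) (ψφ y))

∑-swap : ∀ {A B : Set} xs ys (f : A → B → ℕ) →
         ∑ xs (λ x → ∑ ys (f x)) ≡ ∑ ys (λ y → ∑ xs (λ x → f x y))
∑-swap []       ys f = sym (∑-zero ys λ _ _ → refl)
∑-swap (x ∷ xs) ys f = trans (cong (∑ ys (f x) +_) (∑-swap xs ys f)) (sym (∑-+ ys (f x) _))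

length-filter-T : ∀ {A : Set} (p : A → Bool) xs → length (filter (T? ∘ p) xs) ≡ ∑ xs (⟦_⟧ ∘ p)
length-filter-T p []       = refl
length-filter-T p (x ∷ xs) with p x
... | true  = cong suc (length-filter-T p xs)
... | false = length-filter-T p xs

any⇒∑≢0 : ∀ {A : Set} xs (c : A → Bool) → T (any c xs) → ¬ (∑ xs (⟦_⟧ ∘ c) ≡ 0)
any⇒∑≢0 xs c t z = let x , x∈ , cx = any-∈⁻ c xs t in
  1+n≰n (subst₂ _≤_ (⟦⟧-true cx) z (∑-≥ (⟦_⟧ ∘ c) x∈))

-- The common value of `f` and `f′` need not be known: agreement across the lists makes each
-- function constant on its selected entries as soon as the other list has a selected entry. If one
-- selection is empty, equal counts make both empty.
∑-weighted : ∀ {A B : Set} xs ys (c : A → Bool) (c′ : B → Bool) (f : A → ℕ) (f′ : B → ℕ) →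
             (∀ x y → T (c x) → T (c′ y) → f x ≡ f′ y) →
             ∑ xs (⟦_⟧ ∘ c) ≡ ∑ ys (⟦_⟧ ∘ c′) →
             ∑ xs (λ x → ⟦ c x ⟧ * f x) ≡ ∑ ys (λ y → ⟦ c′ y ⟧ * f′ y)
∑-weighted xs ys c c′ f f′ h e with T-dec (any c xs) | T-dec (any c′ ys)
... | inj₁ t | inj₁ t′ = let x₀ , _ , cx₀ = any-∈⁻ c xs t ; y₀ , _ , cy₀ = any-∈⁻ c′ ys t′ in
  trans (constant xs c f λ x cx → trans (h x y₀ cx cy₀) (sym (h x₀ y₀ cx₀ cy₀)))
  (trans (cong (_* f x₀) e) (sym (constant ys c′ f′ λ y cy → sym (h x₀ y cx₀ cy))))
  where
  constant : ∀ {A : Set} xs (c : A → Bool) (f : A → ℕ) {k} → (∀ x → T (c x) → f x ≡ k) →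
             ∑ xs (λ x → ⟦ c x ⟧ * f x) ≡ ∑ xs (⟦_⟧ ∘ c) * k
  constant xs c f {k} h = trans (∑-cong xs λ x → term x (c x) refl) (∑-*ʳ xs k _)
    where
    term : ∀ x b → c x ≡ b → ⟦ b ⟧ * f x ≡ ⟦ b ⟧ * k
    term x true  e = cong (1 *_) (h x (subst T (sym e) _))
    term x false e = refl
... | inj₁ t | inj₂ n′ = ⊥-elim (any⇒∑≢0 xs c t (trans e (∑-zero ys λ y y∈ → ⟦⟧-false λ cy → n′ (any-∈⁺ c′ ys y y∈ cy))))
... | inj₂ n | inj₁ t′ = ⊥-elim (any⇒∑≢0 ys c′ t′ (trans (sym e) (∑-zero xs λ x x∈ → ⟦⟧-false λ cx → n (any-∈⁺ c xs x x∈ cx))))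
... | inj₂ n | inj₂ n′ = trans (none xs c f n) (sym (none ys c′ f′ n′))
  where
  none : ∀ {A : Set} xs (c : A → Bool) (f : A → ℕ) → ¬ T (any c xs) → ∑ xs (λ x → ⟦ c x ⟧ * f x) ≡ 0
  none xs c f n = ∑-zero xs λ x x∈ → cong (_* f x) (⟦⟧-false λ cx → n (any-∈⁺ c xs x x∈ cx))

foldr-max : ∀ (p : ℕ → Bool) xs k → k ∈ xs → T (p k) → (∀ j → j ∈ xs → T (p j) → j ≤ k) →
            foldr (λ j acc → if p j then j ⊔ acc else acc) 0 xs ≡ k
foldr-max p xs k k∈ pk h = ≤-antisym (below xs h) (above xs k∈ pk)
  where
  below : ∀ xs → (∀ j → j ∈ xs → T (p j) → j ≤ k) → foldr (λ j acc → if p j then j ⊔ acc else acc) 0 xs ≤ k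
  below []       h = z≤n
  below (x ∷ xs) h with p x in eq
  ... | true  = ⊔-lub (h x (here refl) (subst T (sym eq) _)) (below xs λ j → h j ∘ there)
  ... | false = below xs λ j → h j ∘ there
  above : ∀ xs → k ∈ xs → T (p k) → k ≤ foldr (λ j acc → if p j then j ⊔ acc else acc) 0 xs
  above (x ∷ xs) (here refl) pk with p k | pk
  ... | true | _ = m≤m⊔n k _
  above (x ∷ xs) (there k∈) pk with p x
  ... | true  = ≤-trans (above xs k∈ pk) (m≤n⊔m x _)
  ... | false = above xs k∈ pk

-- Positional matching between two duplicate-free lists; z is a junk value.
match : ∀ {A B : Set} → (A → A → Bool) → B → List A → List B → A → B
match _≟_ z []       ys       a = z
match _≟_ z (x ∷ xs) []       a = z
match _≟_ z (x ∷ xs) (y ∷ ys) a with x ≟ a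
... | true  = y
... | false = match _≟_ z xs ys a

module _ {A B : Set} (_≟_ : A → A → Bool) (_≟′_ : B → B → Bool)
         (≟⁻ : ∀ {x y} → T (x ≟ y) → x ≡ y) (≟⁺ : ∀ x → T (x ≟ x))
         (≟′⁻ : ∀ {x y} → T (x ≟′ y) → x ≡ y) (≟′⁺ : ∀ x → T (x ≟′ x))
         (z : A) (z′ : B) where

  match-∈ : ∀ xs ys → length xs ≡ length ys → ∀ {a} → a ∈ xs → match _≟_ z′ xs ys a ∈ ys
  match-∈ (x ∷ xs) (y ∷ ys) e {a} a∈ with x ≟ a in eq | a∈
  ... | true  | _          = here refl
  ... | false | here refl  = ⊥-elim (subst T eq (≟⁺ a))
  ... | false | there a∈xs = there (match-∈ xs ys (suc-injective e) a∈xs)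

  -- The two searches run in lockstep: once the forward search has passed `x`, its result lies in
  -- the rest of `ys`, so the backward search cannot stop at `y`, which does not recur there.
  match-match : ∀ xs ys → Unique ys → length xs ≡ length ys → ∀ {a} → a ∈ xs →
                match _≟′_ z ys xs (match _≟_ z′ xs ys a) ≡ a
  match-match (x ∷ xs) (y ∷ ys) (y∉ ∷ u) e {a} a∈ with x ≟ a in eq | a∈
  match-match (x ∷ xs) (y ∷ ys) (y∉ ∷ u) e {a} a∈ | true | _ with y ≟′ y in eq′
  ... | true  = ≟⁻ (subst T (sym eq) _)
  ... | false = ⊥-elim (subst T eq′ (≟′⁺ y))
  match-match (x ∷ xs) (y ∷ ys) (y∉ ∷ u) e {a} a∈ | false | here refl = ⊥-elim (subst T eq (≟⁺ a))
  match-match (x ∷ xs) (y ∷ ys) (y∉ ∷ u) e {a} a∈ | false | there a∈xs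
    with y ≟′ match _≟_ z′ xs ys a in eq′
  ... | true  = ⊥-elim (All.lookup y∉ (match-∈ xs ys (suc-injective e) a∈xs) (≟′⁻ (subst T (sym eq′) _)))
  ... | false = match-match xs ys u (suc-injective e) a∈xs

module Geometry (𝔽 : FiniteField) where

  open FiniteField 𝔽 renaming (_+_ to infixl 6 _⊕_; _*_ to infixl 7 _⊗_; -_ to infix 8 ⊖_)
  open Over 𝔽

  commutativeRing : CommutativeRing _ _
  commutativeRing = record { isCommutativeRing = isCommutativeRing }

  open CommutativeRing commutativeRing
    using (ring; -‿inverseˡ; -‿inverseʳ; zeroˡ; zeroʳ; distribˡ; distribʳ)
    renaming ( +-identityˡ to ⊕-identityˡ; +-identityʳ to ⊕-identityʳ; +-assoc to ⊕-assoc; +-comm to ⊕-comm; *-assoc to ⊗-assoc; *-comm to ⊗-comm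
             ; *-identityˡ to ⊗-identityˡ; *-identityʳ to ⊗-identityʳ )
  open RingProperties ring using (-1*x≈-x; -0#≈0#; x∙y⁻¹≈ε⇒x≈y; -‿involutive; +-inverseʳ-unique)

  q : ℕ
  q = order

  2≤q : 2 ≤ q
  2≤q = go elements (elements-complete 0#) (elements-complete 1#)
    where
    go : ∀ xs → 0# ∈ xs → 1# ∈ xs → 2 ≤ length xs
    go (x ∷ [])     (here e)  (here e′) = ⊥-elim (0≢1 (trans e (sym e′)))
    go (x ∷ y ∷ xs) _         _         = s≤s (s≤s z≤n)

  q>0 : 1 ≤ q
  q>0 = ≤-trans (s≤s z≤n) 2≤q

  ≡ᶠ⁺ : ∀ {x y} → x ≡ y → T (x ≡ᶠ y)
  ≡ᶠ⁺ = fromWitness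

  ≡ᶠ⁻ : ∀ {x y} → T (x ≡ᶠ y) → x ≡ y
  ≡ᶠ⁻ = toWitness

  ≡ᵛ⁺ : ∀ {n} {u v : Vect n} → u ≡ v → T (u ≡ᵛ v)
  ≡ᵛ⁺ = fromWitness

  ≡ᵛ⁻ : ∀ {n} {u v : Vect n} → T (u ≡ᵛ v) → u ≡ v
  ≡ᵛ⁻ = toWitness

  -- In characteristic 2 the translation x ↦ x + 1 pairs off the elements; of each pair,
  -- [ index x < index (x + 1) ] selects exactly one.
  odd-order⇒1+1≢0 : ¬ (2 ∣ order) → ¬ (1# ⊕ 1# ≡ 0#)
  odd-order⇒1+1≢0 odd 2≡0 = odd (divides r (begin
    q                                                     ≡⟨ *-identityʳ q ⟨
    q * 1                                                 ≡⟨ ∑-const elements 1 ⟨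
    ∑ elements (λ _ → 1)                                  ≡⟨ ∑-cong elements (λ x → sym (one x)) ⟩
    ∑ elements (λ x → low x + low (σ x))                  ≡⟨ ∑-+ elements low (low ∘ σ) ⟩
    r + ∑ elements (low ∘ σ)                              ≡⟨ cong (r +_) (∑-reindex elements-unique elements-complete σ σ σσ σσ low) ⟩
    r + r                                                 ≡⟨ lemma r ⟩
    r * 2                                                 ∎))
    where
    open ≡-Reasoning
    σ : Carrier → Carrier
    σ x = x ⊕ 1#
    σσ : ∀ x → σ (σ x) ≡ x
    σσ x = trans (⊕-assoc x 1# 1#) (trans (cong (x ⊕_) 2≡0) (⊕-identityʳ x))
    idx : Carrier → ℕ
    idx x = toℕ (index (elements-complete x))
    idx-injective : ∀ {x y} → idx x ≡ idx y → x ≡ y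
    idx-injective {x} {y} e = trans (lookup-index (elements-complete x))
      (trans (cong (lookup elements) (toℕ-injective e)) (sym (lookup-index (elements-complete y))))
    low : Carrier → ℕ
    low x = ⟦ idx x <ᵇ idx (σ x) ⟧
    r : ℕ
    r = ∑ elements low
    one : ∀ x → low x + low (σ x) ≡ 1
    one x rewrite σσ x with <-cmp (idx x) (idx (σ x))
    ... | tri< l _ g =
      cong₂ _+_ (⟦⟧-true (<⇒<ᵇ l)) (⟦⟧-false λ t → g (<ᵇ⇒< _ _ t))
    ... | tri≈ _ e _ = ⊥-elim (0≢1 (sym (trans (sym (⊕-identityˡ 1#)) (trans (cong (_⊕ 1#) (sym (-‿inverseˡ x)))
      (trans (⊕-assoc (⊖ x) x 1#) (trans (cong (⊖ x ⊕_) (sym (idx-injective e))) (-‿inverseˡ x)))))))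
    ... | tri> l _ g =
      cong₂ _+_ (⟦⟧-false λ t → l (<ᵇ⇒< _ _ t)) (⟦⟧-true (<⇒<ᵇ g))
    lemma : ∀ r → r + r ≡ r * 2
    lemma = solve-∀

  -- Vectors

  +ᵥ-comm : ∀ {n} (u v : Vect n) → u +ᵥ v ≡ v +ᵥ u
  +ᵥ-comm = VP.zipWith-comm ⊕-comm

  +ᵥ-assoc : ∀ {n} (u v w : Vect n) → (u +ᵥ v) +ᵥ w ≡ u +ᵥ (v +ᵥ w)
  +ᵥ-assoc = VP.zipWith-assoc ⊕-assoc

  +ᵥ-identityˡ : ∀ {n} (u : Vect n) → 0ᵥ +ᵥ u ≡ u
  +ᵥ-identityˡ = VP.zipWith-identityˡ ⊕-identityˡ

  +ᵥ-identityʳ : ∀ {n} (u : Vect n) → u +ᵥ 0ᵥ ≡ u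
  +ᵥ-identityʳ = VP.zipWith-identityʳ ⊕-identityʳ

  ·ᵥ-distribˡ : ∀ {n} c (u v : Vect n) → c ·ᵥ (u +ᵥ v) ≡ (c ·ᵥ u) +ᵥ (c ·ᵥ v)
  ·ᵥ-distribˡ c []      []      = refl
  ·ᵥ-distribˡ c (x ∷ u) (y ∷ v) = cong₂ _∷_ (distribˡ c x y) (·ᵥ-distribˡ c u v)

  ·ᵥ-distribʳ : ∀ {n} c d (u : Vect n) → (c ⊕ d) ·ᵥ u ≡ (c ·ᵥ u) +ᵥ (d ·ᵥ u)
  ·ᵥ-distribʳ c d []      = refl
  ·ᵥ-distribʳ c d (x ∷ u) = cong₂ _∷_ (distribʳ x c d) (·ᵥ-distribʳ c d u)

  ·ᵥ-assoc : ∀ {n} c d (u : Vect n) → (c ⊗ d) ·ᵥ u ≡ c ·ᵥ (d ·ᵥ u)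
  ·ᵥ-assoc c d []      = refl
  ·ᵥ-assoc c d (x ∷ u) = cong₂ _∷_ (⊗-assoc c d x) (·ᵥ-assoc c d u)

  ·ᵥ-identity : ∀ {n} (u : Vect n) → 1# ·ᵥ u ≡ u
  ·ᵥ-identity []      = refl
  ·ᵥ-identity (x ∷ u) = cong₂ _∷_ (⊗-identityˡ x) (·ᵥ-identity u)

  ·ᵥ-zeroˡ : ∀ {n} (u : Vect n) → 0# ·ᵥ u ≡ 0ᵥ
  ·ᵥ-zeroˡ []      = refl
  ·ᵥ-zeroˡ (x ∷ u) = cong₂ _∷_ (zeroˡ x) (·ᵥ-zeroˡ u)

  ·ᵥ-zeroʳ : ∀ {n} c → c ·ᵥ 0ᵥ {n} ≡ 0ᵥ
  ·ᵥ-zeroʳ {zero}  c = refl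
  ·ᵥ-zeroʳ {suc n} c = cong₂ _∷_ (zeroʳ c) (·ᵥ-zeroʳ c)

  cancel-⊖ : ∀ {n} c (u : Vect n) → (c ·ᵥ u) +ᵥ ((⊖ c) ·ᵥ u) ≡ 0ᵥ
  cancel-⊖ c u = trans (sym (·ᵥ-distribʳ c (⊖ c) u)) (trans (cong (_·ᵥ u) (-‿inverseʳ c)) (·ᵥ-zeroˡ u))

  cancel-⊖′ : ∀ {n} c (u : Vect n) → ((⊖ c) ·ᵥ u) +ᵥ (c ·ᵥ u) ≡ 0ᵥ
  cancel-⊖′ c u = trans (+ᵥ-comm _ _) (cancel-⊖ c u)

  add-sub : ∀ {n} x c (u : Vect n) → (x +ᵥ (c ·ᵥ u)) +ᵥ ((⊖ c) ·ᵥ u) ≡ x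
  add-sub x c u = trans (+ᵥ-assoc x _ _) (trans (cong (x +ᵥ_) (cancel-⊖ c u)) (+ᵥ-identityʳ x))

  sub-add : ∀ {n} x c (u : Vect n) → (x +ᵥ ((⊖ c) ·ᵥ u)) +ᵥ (c ·ᵥ u) ≡ x
  sub-add x c u = trans (+ᵥ-assoc x _ _) (trans (cong (x +ᵥ_) (cancel-⊖′ c u)) (+ᵥ-identityʳ x))

  +ᵥ-interchange : ∀ {n} (a b c d : Vect n) → (a +ᵥ b) +ᵥ (c +ᵥ d) ≡ (a +ᵥ c) +ᵥ (b +ᵥ d)
  +ᵥ-interchange a b c d = trans (+ᵥ-assoc a b _) (trans (cong (a +ᵥ_)
    (trans (sym (+ᵥ-assoc b c d)) (trans (cong (_+ᵥ d) (+ᵥ-comm b c)) (+ᵥ-assoc c b d)))) (sym (+ᵥ-assoc a c _)))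

  -- Enumeration of tuples and vectors

  tuples≡product : ∀ {A : Set} (xs : List A) k → tuples xs (suc k) ≡ cartesianProductWith _∷_ xs (tuples xs k)
  tuples≡product xs k = go xs
    where
    go : ∀ ys → concatMap (λ x → map (x Vec.∷_) (tuples xs k)) ys ≡ cartesianProductWith _∷_ ys (tuples xs k)
    go []       = refl
    go (y ∷ ys) = cong (map (y Vec.∷_) (tuples xs k) ++_) (go ys)

  tuples-unique : ∀ {A : Set} {xs : List A} → Unique xs → ∀ k → Unique (tuples xs k)
  tuples-unique u zero    = [] ∷ []
  tuples-unique {xs = xs} u (suc k) rewrite tuples≡product xs k =
    Unique.cartesianProductWith⁺ _∷_ VP.∷-injective u (tuples-unique u k)

  ∈-tuples⁺ : ∀ {A : Set} {xs : List A} {k} {v : Vec A k} → VAll.All (_∈ xs) v → v ∈ tuples xs k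
  ∈-tuples⁺ []           = here refl
  ∈-tuples⁺ {xs = xs} {suc k} (x∈ ∷ v∈) rewrite tuples≡product xs k =
    ∈-cartesianProductWith⁺ _∷_ x∈ (∈-tuples⁺ v∈)

  ∈-tuples⁻ : ∀ {A : Set} {xs : List A} k {v : Vec A k} → v ∈ tuples xs k → VAll.All (_∈ xs) v
  ∈-tuples⁻ zero    {[]} _ = []
  ∈-tuples⁻ {xs = xs} (suc k) {v} v∈ rewrite tuples≡product xs k
    with ∈-cartesianProductWith⁻ Vec._∷_ xs (tuples xs k) v∈
  ... | x , w , x∈ , w∈ , refl = x∈ ∷ ∈-tuples⁻ k w∈

  length-product : ∀ {A B C : Set} (f : A → B → C) xs ys → length (cartesianProductWith f xs ys) ≡ length xs * length ys
  length-product f []       ys = refl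
  length-product f (x ∷ xs) ys = trans (length-++ (map (f x) ys)) (cong₂ _+_ (length-map (f x) ys) (length-product f xs ys))

  length-tuples : ∀ {A : Set} (xs : List A) k → length (tuples xs k) ≡ length xs ^ k
  length-tuples xs zero    = refl
  length-tuples xs (suc k) rewrite tuples≡product xs k =
    trans (length-product _∷_ xs (tuples xs k)) (cong (length xs *_) (length-tuples xs k))

  allVecs-unique : ∀ n → Unique (allVecs n)
  allVecs-unique = tuples-unique elements-unique

  ∈-allVecs : ∀ {n} (v : Vect n) → v ∈ allVecs n
  ∈-allVecs v = ∈-tuples⁺ (VAll.universal elements-complete v)

  length-allVecs : ∀ n → length (allVecs n) ≡ q ^ n
  length-allVecs = length-tuples elements

  -- Subspaces as Boolean predicates

  size : ∀ {n} → (Vect n → Bool) → ℕ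
  size {n} p = ∑ (allVecs n) (λ v → ⟦ p v ⟧)

  ∑-translate : ∀ {n} c (a : Vect n) (f : Vect n → ℕ) →
                ∑ (allVecs n) (λ v → f (v +ᵥ (c ·ᵥ a))) ≡ ∑ (allVecs n) f
  ∑-translate {n} c a f = ∑-reindex (allVecs-unique n) ∈-allVecs (_+ᵥ (c ·ᵥ a)) (_+ᵥ ((⊖ c) ·ᵥ a))
    (λ x → sub-add x c a) (λ x → add-sub x c a) f

  record Sub {n} (p : Vect n → Bool) : Set where
    field
      zero∈ : T (p 0ᵥ)
      add   : ∀ {u v} → T (p u) → T (p v) → T (p (u +ᵥ v))
      smul  : ∀ c {u} → T (p u) → T (p (c ·ᵥ u))
  open Sub

  sub-cancel : ∀ {n} {p : Vect n → Bool} → Sub p → ∀ {u c v} → T (p (u +ᵥ (c ·ᵥ v))) → T (p v) → T (p u)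
  sub-cancel {p = p} s {u} {c} {v} h pv = subst (T ∘ p) (add-sub u c v) (add s h (smul s (⊖ c) pv))

  unscale : ∀ {n} {p : Vect n → Bool} → Sub p → ∀ {c v} → ¬ (c ≡ 0#) → T (p (c ·ᵥ v)) → T (p v)
  unscale {p = p} s {c} {v} c≢0 h with inverse c c≢0
  ... | d , cd = subst (T ∘ p) (trans (sym (·ᵥ-assoc d c v)) (trans (cong (_·ᵥ v) (trans (⊗-comm d c) cd)) (·ᵥ-identity v))) (smul s d h)

  size>0 : ∀ {n} {p : Vect n → Bool} → Sub p → 1 ≤ size p
  size>0 {n} {p} s = subst (_≤ size p) (⟦⟧-true (zero∈ s)) (∑-≥ (λ v → ⟦ p v ⟧) (∈-allVecs 0ᵥ))

  size-mono : ∀ {n} {p r : Vect n → Bool} → (∀ v → T (p v) → T (r v)) → size p ≤ size r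
  size-mono {n} h = ∑-mono (allVecs n) (λ v → ⟦⟧-mono (h v))

  size-≤⇒⊇ : ∀ {n} {p r : Vect n → Bool} → (∀ v → T (p v) → T (r v)) → size r ≤ size p → ∀ v → T (r v) → T (p v)
  size-≤⇒⊇ {n} {p} {r} h e v rv =
    subst T (sym (⟦⟧-injective (∑-≤⇒≗ (allVecs n) (λ v → ⟦⟧-mono (h v)) e v (∈-allVecs v)))) rv

  size-total : ∀ n → size {n} (λ _ → true) ≡ q ^ n
  size-total n = trans (∑-const (allVecs n) 1) (trans (*-identityʳ _) (length-allVecs n))

  size≤ : ∀ {n} (p : Vect n → Bool) → size p ≤ q ^ n
  size≤ {n} p = subst (size p ≤_) (size-total n) (size-mono {p = p} λ _ _ → _)

  record Linear {n} (f : Vect n → Carrier) : Set where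
    field
      f-add  : ∀ u v → f (u +ᵥ v) ≡ f u ⊕ f v
      f-smul : ∀ c u → f (c ·ᵥ u) ≡ c ⊗ f u
  open Linear

  -- Translation by `(b ⊗ y) ·ᵥ x`, where `y` inverts `f x`, carries the fibre over 0 onto the fibre
  -- over `b`, so all `q` fibres in `p` are equally large. Fibres over nonzero `a` serve the affine
  -- functions in `zeros-perp`.
  fibre-size : ∀ {n} {p : Vect n → Bool} {f} → Sub p → Linear f → ∀ {x} → T (p x) → ¬ (f x ≡ 0#) → ∀ a →
               q * ∑ (allVecs n) (λ v → ⟦ p v ∧ (f v ≡ᶠ a) ⟧) ≡ size p
  fibre-size {n} {p} {f} s l {x} px fx≢0 a with inverse (f x) fx≢0
  ... | y , xy = begin
    q * h a                                                              ≡⟨ cong (q *_) (h-const a) ⟩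
    q * h 0#                                                             ≡⟨ ∑-const elements (h 0#) ⟨
    ∑ elements (λ _ → h 0#)                                              ≡⟨ ∑-cong elements (λ b → sym (h-const b)) ⟩
    ∑ elements h                                                         ≡⟨ ∑-swap elements (allVecs n) _ ⟩
    ∑ (allVecs n) (λ v → ∑ elements (λ b → ⟦ p v ∧ (f v ≡ᶠ b) ⟧))        ≡⟨ ∑-cong (allVecs n) inner ⟩
    size p                                                               ∎
    where
    open ≡-Reasoning
    h : Carrier → ℕ
    h b = ∑ (allVecs n) (λ v → ⟦ p v ∧ (f v ≡ᶠ b) ⟧)
    f-shift : ∀ b v → f (v +ᵥ ((b ⊗ y) ·ᵥ x)) ≡ f v ⊕ b
    f-shift b v = trans (f-add l v _) (cong (f v ⊕_) (trans (f-smul l _ x) (trans (⊗-assoc b y (f x))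
      (trans (cong (b ⊗_) (trans (⊗-comm y (f x)) xy)) (⊗-identityʳ b)))))
    f-iff₁ : ∀ b z → z ⊕ b ≡ b → z ≡ 0#
    f-iff₁ b z e = trans (sym (trans (⊕-assoc z b (⊖ b)) (trans (cong (z ⊕_) (-‿inverseʳ b)) (⊕-identityʳ z))))
      (trans (cong (_⊕ ⊖ b) e) (-‿inverseʳ b))
    h-const : ∀ b → h b ≡ h 0#
    h-const b = trans (sym (∑-translate (b ⊗ y) x _)) (∑-cong (allVecs n) λ v → cong ⟦_⟧ (cong₂ _∧_
      (bool-ext (λ t → sub-cancel s t px) (λ t → add s t (smul s (b ⊗ y) px)))
      (bool-ext (λ t → ≡ᶠ⁺ (f-iff₁ b (f v) (trans (sym (f-shift b v)) (≡ᶠ⁻ t))))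
                (λ t → ≡ᶠ⁺ (trans (f-shift b v) (trans (cong (_⊕ b) (≡ᶠ⁻ t)) (⊕-identityˡ b)))))))
    inner : ∀ v → ∑ elements (λ b → ⟦ p v ∧ (f v ≡ᶠ b) ⟧) ≡ ⟦ p v ⟧
    inner v with p v
    ... | true  = ∑-unique (λ b → f v ≡ᶠ b) elements-unique (elements-complete (f v)) (≡ᶠ⁺ refl) (λ b t → sym (≡ᶠ⁻ t))
    ... | false = ∑-zero elements λ _ _ → refl

  q≡ : q ≡ suc (q ∸ 1)
  q≡ = sym (m+[n∸m]≡n q>0)

  -- The kernel is all of `p` or a q-th part of it. The Boolean `b`, which decides whether `f`
  -- vanishes on `p`, merges the two cases into one formula that can be summed over a family of
  -- functionals.
  kernel-size : ∀ {n} {p : Vect n → Bool} {f} → Sub p → Linear f → ∀ b →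
                (T b → ∀ v → T (p v) → f v ≡ 0#) → (¬ T b → ∃ λ v → T (p v) × ¬ (f v ≡ 0#)) →
                q * ∑ (allVecs n) (λ v → ⟦ p v ∧ (f v ≡ᶠ 0#) ⟧) ≡ size p + (q ∸ 1) * (⟦ b ⟧ * size p)
  kernel-size {n} {p} {f} s l true h₁ h₂ = trans (cong (q *_) (∑-cong (allVecs n) λ v → cong ⟦_⟧
    (bool-ext (proj₁ ∘ ∧⁻) (λ pv → ∧⁺ pv (≡ᶠ⁺ (h₁ _ v pv))))))
    (trans (cong (_* size p) q≡) (cong (λ z → size p + (q ∸ 1) * z) (sym (*-identityˡ (size p)))))
  kernel-size {n} {p} {f} s l false h₁ h₂ with h₂ (λ ())
  ... | v , pv , fv≢0 = trans (fibre-size s l pv fv≢0 0#)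
    (sym (trans (cong (size p +_) (*-zeroʳ (q ∸ 1))) (+-identityʳ (size p))))

  -- Orthogonal complements

  perp : ∀ {n} → Form n → (Vect n → Bool) → Vect n → Bool
  perp {n} B p v = all (λ u → not (p u) ∨ (B u v ≡ᶠ 0#)) (allVecs n)

  perp⁻ : ∀ {n} (B : Form n) p {v} → T (perp B p v) → ∀ u → T (p u) → B u v ≡ 0#
  perp⁻ {n} B p {v} h u pu with p u | all-∈⁻ _ (allVecs n) h u (∈-allVecs u)
  ... | true | t = ≡ᶠ⁻ t

  perp⁺ : ∀ {n} (B : Form n) p {v} → (∀ u → T (p u) → B u v ≡ 0#) → T (perp B p v)
  perp⁺ {n} B p {v} h = all-∈⁺ _ (allVecs n) λ u _ → case u (h u)
    where
    case : ∀ u → (T (p u) → B u v ≡ 0#) → T (not (p u) ∨ (B u v ≡ᶠ 0#))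
    case u k with p u
    ... | true  = ≡ᶠ⁺ (k _)
    ... | false = _

  ¬perp : ∀ {n} (B : Form n) p {v} → ¬ T (perp B p v) → ∃ λ u → T (p u) × ¬ (B u v ≡ 0#)
  ¬perp {n} B p {v} h with all-or-counterexample (λ u → not (p u) ∨ (B u v ≡ᶠ 0#)) (allVecs n)
  ... | inj₁ k = ⊥-elim (h (all-∈⁺ _ (allVecs n) k))
  ... | inj₂ (u , _ , k) = u , case k
    where
    case : ¬ T (not (p u) ∨ (B u v ≡ᶠ 0#)) → T (p u) × ¬ (B u v ≡ 0#)
    case k with p u
    ... | true  = _ , λ e → k (≡ᶠ⁺ e)
    ... | false = ⊥-elim (k _)

  module _ {n} {B : Form n} (bil : IsBilinear B) where
    open IsBilinear bil

    linearˡ : ∀ v → Linear (λ u → B u v)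
    linearˡ v = record { f-add = λ u w → addˡ u w v ; f-smul = λ c u → smulˡ c u v }

    linearʳ : ∀ v → Linear (λ u → B v u)
    linearʳ v = record { f-add = λ u w → addʳ v u w ; f-smul = λ c u → smulʳ c v u }

    -- Double counting of the pairs (u , v) with u ∈ p and B u v = 0.
    perp-size : NonDegenerate B → ∀ {p} → Sub p → size p * size (perp B p) ≡ q ^ n
    -- For fixed v, the functional u ↦ B u v vanishes on `p` exactly when v is in the complement;
    -- for fixed u in `p`, the functional v ↦ B u v vanishes exactly when u = 0, by nondegeneracy.
    -- The two totals share the summand `q ^ n * size p`, and the remainders share the positive
    -- factor `q ∸ 1`.
    perp-size nondeg {p} s = *-cancelˡ-≡ _ _ (q ∸ 1) {{>-nonZero (∸-monoˡ-≤ 1 2≤q)}} (+-cancelˡ-≡ (q ^ n * size p) _ _ (begin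
      q ^ n * size p + (q ∸ 1) * (size p * size (perp B p))     ≡⟨ byʳ ⟨
      q * pairs                                                 ≡⟨ byˡ ⟩
      q ^ n * size p + (q ∸ 1) * q ^ n                          ∎))
      where
      open ≡-Reasoning
      pairs : ℕ
      pairs = ∑ (allVecs n) (λ v → ∑ (allVecs n) (λ u → ⟦ p u ∧ (B u v ≡ᶠ 0#) ⟧))
      byʳ : q * pairs ≡ q ^ n * size p + (q ∸ 1) * (size p * size (perp B p))
      byʳ = begin
        q * pairs
          ≡⟨ ∑-*ˡ (allVecs n) q _ ⟨
        ∑ (allVecs n) (λ v → q * ∑ (allVecs n) (λ u → ⟦ p u ∧ (B u v ≡ᶠ 0#) ⟧))
          ≡⟨ ∑-cong (allVecs n) (λ v → kernel-size s (linearˡ v) (perp B p v) (perp⁻ B p) (¬perp B p)) ⟩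
        ∑ (allVecs n) (λ v → size p + (q ∸ 1) * (⟦ perp B p v ⟧ * size p))
          ≡⟨ ∑-+ (allVecs n) _ _ ⟩
        ∑ (allVecs n) (λ v → size p) + ∑ (allVecs n) (λ v → (q ∸ 1) * (⟦ perp B p v ⟧ * size p))
          ≡⟨ cong₂ _+_ (trans (∑-const (allVecs n) (size p)) (cong (_* size p) (length-allVecs n)))
               (trans (∑-*ˡ (allVecs n) (q ∸ 1) _) (cong ((q ∸ 1) *_) (trans (∑-*ʳ (allVecs n) (size p) _) (*-comm (size (perp B p)) (size p))))) ⟩
        q ^ n * size p + (q ∸ 1) * (size p * size (perp B p)) ∎
      total : Sub {n} (λ _ → true)
      total = record { zero∈ = _ ; add = λ _ _ → _ ; smul = λ _ _ → _ }
      vanish : ∀ u → ¬ T (u ≡ᵛ 0ᵥ) → ∃ λ v → T true × ¬ (B u v ≡ 0#)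
      vanish u u≢0 with all-or-counterexample (λ v → B u v ≡ᶠ 0#) (allVecs n)
      ... | inj₁ k           = ⊥-elim (u≢0 (≡ᵛ⁺ (nondeg u λ v → ≡ᶠ⁻ (k v (∈-allVecs v)))))
      ... | inj₂ (v , _ , k) = v , _ , λ e → k (≡ᶠ⁺ e)
      B0 : ∀ u → T (u ≡ᵛ 0ᵥ) → ∀ v → T true → B u v ≡ 0#
      B0 u t v _ = trans (cong (λ z → B z v) (trans (≡ᵛ⁻ t) (sym (·ᵥ-zeroˡ u)))) (trans (smulˡ 0# u v) (zeroˡ _))
      byˡ : q * pairs ≡ q ^ n * size p + (q ∸ 1) * q ^ n
      byˡ = begin
        q * pairs
          ≡⟨ cong (q *_) (∑-swap (allVecs n) (allVecs n) _) ⟩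
        q * ∑ (allVecs n) (λ u → ∑ (allVecs n) (λ v → ⟦ p u ∧ (B u v ≡ᶠ 0#) ⟧))
          ≡⟨ ∑-*ˡ (allVecs n) q _ ⟨
        ∑ (allVecs n) (λ u → q * ∑ (allVecs n) (λ v → ⟦ p u ∧ (B u v ≡ᶠ 0#) ⟧))
          ≡⟨ ∑-cong (allVecs n) row ⟩
        ∑ (allVecs n) (λ u → q ^ n * ⟦ p u ⟧ + (q ∸ 1) * q ^ n * ⟦ u ≡ᵛ 0ᵥ ⟧)
          ≡⟨ ∑-+ (allVecs n) _ _ ⟩
        ∑ (allVecs n) (λ u → q ^ n * ⟦ p u ⟧) + ∑ (allVecs n) (λ u → (q ∸ 1) * q ^ n * ⟦ u ≡ᵛ 0ᵥ ⟧)
          ≡⟨ cong₂ _+_ (∑-*ˡ (allVecs n) (q ^ n) _) (trans (∑-*ˡ (allVecs n) ((q ∸ 1) * q ^ n) _)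
               (trans (cong ((q ∸ 1) * q ^ n *_) (∑-unique (_≡ᵛ 0ᵥ) (allVecs-unique n) (∈-allVecs 0ᵥ) (≡ᵛ⁺ refl) (λ _ → ≡ᵛ⁻)))
                 (*-identityʳ _))) ⟩
        q ^ n * size p + (q ∸ 1) * q ^ n ∎
        where
        row : ∀ u → q * ∑ (allVecs n) (λ v → ⟦ p u ∧ (B u v ≡ᶠ 0#) ⟧) ≡ q ^ n * ⟦ p u ⟧ + (q ∸ 1) * q ^ n * ⟦ u ≡ᵛ 0ᵥ ⟧
        row u with T-dec (p u)
        ... | inj₁ pu = begin
          q * ∑ (allVecs n) (λ v → ⟦ p u ∧ (B u v ≡ᶠ 0#) ⟧)
            ≡⟨ cong (q *_) (∑-cong (allVecs n) λ v → cong ⟦_⟧ (bool-ext (proj₂ ∘ ∧⁻) (∧⁺ pu))) ⟩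
          q * ∑ (allVecs n) (λ v → ⟦ true ∧ (B u v ≡ᶠ 0#) ⟧)
            ≡⟨ kernel-size total (linearʳ u) (u ≡ᵛ 0ᵥ) (B0 u) (vanish u) ⟩
          size {n} (λ _ → true) + (q ∸ 1) * (⟦ u ≡ᵛ 0ᵥ ⟧ * size {n} (λ _ → true))
            ≡⟨ cong (λ z → z + (q ∸ 1) * (⟦ u ≡ᵛ 0ᵥ ⟧ * z)) (size-total n) ⟩
          q ^ n + (q ∸ 1) * (⟦ u ≡ᵛ 0ᵥ ⟧ * q ^ n)
            ≡⟨ cong₂ _+_ (sym (trans (cong (q ^ n *_) (⟦⟧-true pu)) (*-identityʳ _)))
                 (trans (cong ((q ∸ 1) *_) (*-comm ⟦ u ≡ᵛ 0ᵥ ⟧ (q ^ n))) (sym (*-assoc (q ∸ 1) (q ^ n) _))) ⟩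
          q ^ n * ⟦ p u ⟧ + (q ∸ 1) * q ^ n * ⟦ u ≡ᵛ 0ᵥ ⟧ ∎
        ... | inj₂ npu = begin
          q * ∑ (allVecs n) (λ v → ⟦ p u ∧ (B u v ≡ᶠ 0#) ⟧)
            ≡⟨ cong (q *_) (∑-zero (allVecs n) λ v _ → ⟦⟧-false (npu ∘ proj₁ ∘ ∧⁻)) ⟩
          q * 0
            ≡⟨ *-zeroʳ q ⟩
          0 ≡⟨ cong₂ _+_ (trans (cong (q ^ n *_) (⟦⟧-false npu)) (*-zeroʳ (q ^ n)))
                 (trans (cong ((q ∸ 1) * q ^ n *_) (⟦⟧-false λ t → npu (subst (T ∘ p) (sym (≡ᵛ⁻ t)) (zero∈ s)))) (*-zeroʳ ((q ∸ 1) * q ^ n))) ⟨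
          q ^ n * ⟦ p u ⟧ + (q ∸ 1) * q ^ n * ⟦ u ≡ᵛ 0ᵥ ⟧ ∎

  -- Adjoining a vector to a subspace

  adjoin : ∀ {n} → (Vect n → Bool) → Vect n → Vect n → Bool
  adjoin p v x = any (λ c → p (x +ᵥ (c ·ᵥ v))) elements

  adjoin⁺ : ∀ {n} (p : Vect n → Bool) v x c → T (p (x +ᵥ (c ·ᵥ v))) → T (adjoin p v x)
  adjoin⁺ p v x c = any-∈⁺ _ elements c (elements-complete c)

  adjoin⁻ : ∀ {n} (p : Vect n → Bool) v x → T (adjoin p v x) → ∃ λ c → T (p (x +ᵥ (c ·ᵥ v)))
  adjoin⁻ p v x t = let c , _ , h = any-∈⁻ _ elements t in c , h

  module _ {n} {p : Vect n → Bool} (s : Sub p) (v : Vect n) where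

    adjoin-⊇ : ∀ {x} → T (p x) → T (adjoin p v x)
    adjoin-⊇ {x} px = adjoin⁺ p v x 0# (add s px (subst (T ∘ p) (sym (·ᵥ-zeroˡ v)) (zero∈ s)))

    adjoin-∋ : T (adjoin p v v)
    -- The scalar sought by `adjoin` is the negative of the coefficient of `v`.
    adjoin-∋ = adjoin⁺ p v v (⊖ 1#) (subst (T ∘ p)
      (sym (trans (cong (_+ᵥ ((⊖ 1#) ·ᵥ v)) (sym (·ᵥ-identity v))) (cancel-⊖ 1# v))) (zero∈ s))

    adjoin-sub : Sub (adjoin p v)
    adjoin-sub .zero∈ = adjoin-⊇ (zero∈ s)
    adjoin-sub .add {x} {y} hx hy with adjoin⁻ p v x hx | adjoin⁻ p v y hy
    ... | c , px | d , py = adjoin⁺ p v (x +ᵥ y) (c ⊕ d) (subst (T ∘ p)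
      (trans (+ᵥ-interchange x _ y _) (cong ((x +ᵥ y) +ᵥ_) (sym (·ᵥ-distribʳ c d v)))) (add s px py))
    adjoin-sub .smul e {x} hx with adjoin⁻ p v x hx
    ... | c , px = adjoin⁺ p v (e ·ᵥ x) (e ⊗ c) (subst (T ∘ p)
      (trans (·ᵥ-distribˡ e x _) (cong ((e ·ᵥ x) +ᵥ_) (sym (·ᵥ-assoc e c v)))) (smul s e px))

    -- At most one scalar moves a given `x` into `p`, since the difference of two such translates
    -- would be a nonzero multiple of `v` inside `p`. Hence `adjoin p v` is the disjoint union of
    -- `q` translates of `p`.
    adjoin-size : ¬ T (p v) → size (adjoin p v) ≡ q * size p
    adjoin-size v∉p = begin
      ∑ (allVecs n) (λ x → ⟦ adjoin p v x ⟧)                              ≡⟨ ∑-cong (allVecs n) (λ x → ∑-any _ elements-unique (once x)) ⟩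
      ∑ (allVecs n) (λ x → ∑ elements (λ c → ⟦ p (x +ᵥ (c ·ᵥ v)) ⟧))      ≡⟨ ∑-swap (allVecs n) elements _ ⟩
      ∑ elements (λ c → ∑ (allVecs n) (λ x → ⟦ p (x +ᵥ (c ·ᵥ v)) ⟧))      ≡⟨ ∑-cong elements (λ c → ∑-translate c v (λ x → ⟦ p x ⟧)) ⟩
      ∑ elements (λ _ → size p)                                           ≡⟨ ∑-const elements (size p) ⟩
      q * size p                                                          ∎
      where
      open ≡-Reasoning
      difference : ∀ x c d → (x +ᵥ (c ·ᵥ v)) +ᵥ ((⊖ 1#) ·ᵥ (x +ᵥ (d ·ᵥ v))) ≡ (c ⊕ ⊖ d) ·ᵥ v
      difference x c d = begin
        (x +ᵥ (c ·ᵥ v)) +ᵥ ((⊖ 1#) ·ᵥ (x +ᵥ (d ·ᵥ v)))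
          ≡⟨ cong ((x +ᵥ (c ·ᵥ v)) +ᵥ_) (·ᵥ-distribˡ (⊖ 1#) x _) ⟩
        (x +ᵥ (c ·ᵥ v)) +ᵥ (((⊖ 1#) ·ᵥ x) +ᵥ ((⊖ 1#) ·ᵥ (d ·ᵥ v)))
          ≡⟨ +ᵥ-interchange x _ _ _ ⟩
        (x +ᵥ ((⊖ 1#) ·ᵥ x)) +ᵥ ((c ·ᵥ v) +ᵥ ((⊖ 1#) ·ᵥ (d ·ᵥ v)))
          ≡⟨ cong₂ _+ᵥ_ (trans (cong (_+ᵥ ((⊖ 1#) ·ᵥ x)) (sym (·ᵥ-identity x))) (cancel-⊖ 1# x))
               (cong ((c ·ᵥ v) +ᵥ_) (trans (sym (·ᵥ-assoc (⊖ 1#) d v)) (cong (_·ᵥ v) (-1*x≈-x d)))) ⟩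
        0ᵥ +ᵥ ((c ·ᵥ v) +ᵥ ((⊖ d) ·ᵥ v))
          ≡⟨ +ᵥ-identityˡ _ ⟩
        (c ·ᵥ v) +ᵥ ((⊖ d) ·ᵥ v)
          ≡⟨ ·ᵥ-distribʳ c (⊖ d) v ⟨
        (c ⊕ ⊖ d) ·ᵥ v ∎
      once : ∀ x c d → T (p (x +ᵥ (c ·ᵥ v))) → T (p (x +ᵥ (d ·ᵥ v))) → c ≡ d
      once x c d hc hd with c ≟ d
      ... | yes e = e
      ... | no c≢d = ⊥-elim (v∉p (unscale s (λ e → c≢d (x∙y⁻¹≈ε⇒x≈y c d e))
        (subst (T ∘ p) (difference x c d) (add s hc (smul s (⊖ 1#) hd)))))

  adjoin-least : ∀ {n} {p r : Vect n → Bool} {v} → Sub r → (∀ x → T (p x) → T (r x)) → T (r v) →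
                 ∀ x → T (adjoin p v x) → T (r x)
  adjoin-least {p = p} {v = v} s h rv x t = sub-cancel s (h _ (proj₂ (adjoin⁻ p v x t))) rv

  -- Singular vectors and balanced forms

  Isotropic : ∀ {n} → Form n → (Vect n → Bool) → Set
  Isotropic B p = ∀ u v → T (p u) → T (p v) → B u v ≡ 0#

  -- For an isotropic subspace `p` and a reflexive bilinear form these are exactly the vectors that
  -- can be adjoined without losing isotropy, the vectors of `p` included.
  singular : ∀ {n} → Form n → (Vect n → Bool) → Vect n → Bool
  singular B p v = perp B p v ∧ (B v v ≡ᶠ 0#)

  isotropic⇒singular : ∀ {n} {B : Form n} {p} → Isotropic B p → ∀ v → T (p v) → T (singular B p v)
  isotropic⇒singular {B = B} {p} iso v pv = ∧⁺ (perp⁺ B p λ u pu → iso u v pu pv) (≡ᶠ⁺ (iso v v pv pv))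

  -- Each vector is a member of `p` plus a multiple of `v`, and the four terms of the expansion
  -- vanish separately. Reflexivity is used where `v` stands on the left, because `perp` puts `p` on
  -- the left.
  adjoin-isotropic : ∀ {n} {B : Form n} {p v} → IsBilinear B → (∀ u w → B u w ≡ 0# → B w u ≡ 0#) →
                     Isotropic B p → T (singular B p v) → Isotropic B (adjoin p v)
  adjoin-isotropic {B = B} {p} {v} bil reflexive iso t x y hx hy
    with adjoin⁻ p v x hx | adjoin⁻ p v y hy
  ... | c , px | d , py = begin
    B x y
      ≡⟨ cong₂ B (add-sub x c v) (add-sub y d v) ⟨
    B (s +ᵥ ((⊖ c) ·ᵥ v)) (r +ᵥ ((⊖ d) ·ᵥ v))
      ≡⟨ trans (addˡ _ _ _) (cong₂ _⊕_ (addʳ _ _ _) (addʳ _ _ _)) ⟩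
    (B s r ⊕ B s ((⊖ d) ·ᵥ v)) ⊕ (B ((⊖ c) ·ᵥ v) r ⊕ B ((⊖ c) ·ᵥ v) ((⊖ d) ·ᵥ v))
      ≡⟨ cong₂ _⊕_ (cong₂ _⊕_ (iso s r px py) (trans (smulʳ _ _ _) (times0 _ (v⊥ s px))))
           (cong₂ _⊕_ (trans (smulˡ _ _ _) (times0 _ (reflexive r v (v⊥ r py)))) (trans (smulˡ _ _ _)
             (times0 _ (trans (smulʳ _ _ _) (times0 _ (≡ᶠ⁻ (proj₂ (∧⁻ t)))))))) ⟩
    (0# ⊕ 0#) ⊕ (0# ⊕ 0#)
      ≡⟨ trans (cong₂ _⊕_ (⊕-identityˡ 0#) (⊕-identityˡ 0#)) (⊕-identityˡ 0#) ⟩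
    0# ∎
    where
    open ≡-Reasoning
    open IsBilinear bil
    s = x +ᵥ (c ·ᵥ v)
    r = y +ᵥ (d ·ᵥ v)
    v⊥ : ∀ u → T (p u) → B u v ≡ 0#
    v⊥ = perp⁻ B p (proj₁ (∧⁻ t))
    times0 : ∀ k {z} → z ≡ 0# → k ⊗ z ≡ 0#
    times0 k refl = zeroʳ k

  -- All that the enumeration of isotropic flags needs to know about the form.
  record Balanced {n} (B : Form n) (K : ℕ) : Set where
    field
      bil       : IsBilinear B
      reflexive : ∀ u v → B u v ≡ 0# → B v u ≡ 0#
      balance   : ∀ {p} → Sub p → Isotropic B p → size p * size (singular B p) ≡ K

  symplectic-balanced : ∀ {n} {ω : Form n} → IsSymplectic ω → Balanced ω (q ^ n)
  symplectic-balanced {n} {ω} sp = record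
    { bil       = bilinear
    ; reflexive = λ u v e → trans (skew u v) (trans (cong ⊖_ e) -0#≈0#)
    ; balance   = λ {p} s iso → trans (cong (size p *_) (∑-cong (allVecs n) λ v →
                    cong ⟦_⟧ (bool-ext (proj₁ ∘ ∧⁻) (λ t → ∧⁺ t (≡ᶠ⁺ (alternating v))))))
                    (perp-size bilinear nondeg s)
    }
    where
    open IsSymplectic sp
    open IsBilinear bilinear
    open ≡-Reasoning
    skew : ∀ u v → ω v u ≡ ⊖ (ω u v)
    skew u v = +-inverseʳ-unique (ω u v) (ω v u) (begin
      ω u v ⊕ ω v u                         ≡⟨ cong₂ _⊕_ (⊕-identityˡ _) (⊕-identityʳ _) ⟨
      (0# ⊕ ω u v) ⊕ (ω v u ⊕ 0#)           ≡⟨ cong₂ _⊕_ (cong (_⊕ ω u v) (alternating u)) (cong (ω v u ⊕_) (alternating v)) ⟨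
      (ω u u ⊕ ω u v) ⊕ (ω v u ⊕ ω v v)     ≡⟨ trans (addˡ _ _ _) (cong₂ _⊕_ (addʳ _ _ _) (addʳ _ _ _)) ⟨
      ω (u +ᵥ v) (u +ᵥ v)                   ≡⟨ alternating (u +ᵥ v) ⟩
      0#                                    ∎)

  -- Counting singular vectors in an orthogonal space

  ∑-translate₁ : ∀ {n} (a : Vect n) (f : Vect n → ℕ) → ∑ (allVecs n) (λ v → f (v +ᵥ a)) ≡ ∑ (allVecs n) f
  ∑-translate₁ {n} a f = trans (∑-cong (allVecs n) λ v → cong (λ z → f (v +ᵥ z)) (sym (·ᵥ-identity a))) (∑-translate 1# a f)

  module Orthogonal {n} {B : Form n} (bil : IsBilinear B) (symm : ∀ u v → B u v ≡ B v u)
                    (nondeg : NonDegenerate B) (2≢0 : ¬ (1# ⊕ 1# ≡ 0#)) where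
    open IsBilinear bil
    open ≡-Reasoning

    -- This is N at the zero subspace, whose complement has `q ^ n` elements. Thus `zeros-perp` is
    -- the subtraction-free form of the constancy of q·N(S) - ∣S^⊥∣.
    zeros : ℕ
    zeros = ∑ (allVecs n) (λ v → ⟦ B v v ≡ᶠ 0# ⟧)

    2≢0-cancel : ∀ {z} → (1# ⊕ 1#) ⊗ z ≡ 0# → z ≡ 0#
    2≢0-cancel {z} e with inverse (1# ⊕ 1#) 2≢0
    ... | h , 2h = begin
      z                       ≡⟨ ⊗-identityˡ z ⟨
      1# ⊗ z                  ≡⟨ cong (_⊗ z) (trans (sym 2h) (⊗-comm _ _)) ⟩
      (h ⊗ (1# ⊕ 1#)) ⊗ z     ≡⟨ ⊗-assoc _ _ _ ⟩
      h ⊗ ((1# ⊕ 1#) ⊗ z)     ≡⟨ cong (h ⊗_) e ⟩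
      h ⊗ 0#                  ≡⟨ zeroʳ h ⟩
      0#                      ∎

    -- Double counting of the pairs (m , u) with m ∈ p and u + m singular. For fixed u the form
    -- B (u + m) (u + m) is affine in m, since p is isotropic.
    zeros-perp : ∀ {p} → Sub p → Isotropic B p → q * zeros + size (perp B p) ≡ q * size (singular B p) + q ^ n
    zeros-perp {p} s iso = *-cancelˡ-≡ _ _ (size p) {{>-nonZero (size>0 s)}} (begin
      size p * (q * zeros + size (perp B p))
        ≡⟨ lemma₁ (size p) q zeros _ ⟩
      q * (size p * zeros) + size p * size (perp B p)
        ≡⟨ cong (λ z → q * z + size p * size (perp B p)) swapped ⟩
      q * ∑ (allVecs n) g + size p * size (perp B p)
        ≡⟨ cong₂ _+_ (∑-*ˡ (allVecs n) q g) (∑-*ˡ (allVecs n) (size p) _) ⟨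
      ∑ (allVecs n) (λ u → q * g u) + ∑ (allVecs n) (λ u → size p * ⟦ perp B p u ⟧)
        ≡⟨ ∑-+ (allVecs n) _ _ ⟨
      ∑ (allVecs n) (λ u → q * g u + size p * ⟦ perp B p u ⟧)
        ≡⟨ ∑-cong (allVecs n) row ⟩
      ∑ (allVecs n) (λ u → q * size p * ⟦ singular B p u ⟧ + size p)
        ≡⟨ ∑-+ (allVecs n) _ _ ⟩
      ∑ (allVecs n) (λ u → q * size p * ⟦ singular B p u ⟧) + ∑ (allVecs n) (λ _ → size p)
        ≡⟨ cong₂ _+_ (∑-*ˡ (allVecs n) (q * size p) _) (trans (∑-const (allVecs n) (size p)) (cong (_* size p) (length-allVecs n))) ⟩
      q * size p * size (singular B p) + q ^ n * size p
        ≡⟨ lemma₂ (size p) q (size (singular B p)) (q ^ n) ⟩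
      size p * (q * size (singular B p) + q ^ n) ∎)
      where
      lemma₁ : ∀ a b c d → a * (b * c + d) ≡ b * (a * c) + a * d
      lemma₁ = solve-∀
      lemma₂ : ∀ a b c d → b * a * c + d * a ≡ a * (b * c + d)
      lemma₂ = solve-∀
      lemma₃ : ∀ a b c → a * (b * c) + b * 1 ≡ a * b * c + b
      lemma₃ = solve-∀
      lemma₄ : ∀ a b → b + b * 0 ≡ a * b * 0 + b
      lemma₄ = solve-∀
      B₊ : Vect n → Vect n → Carrier
      B₊ u m = B (u +ᵥ m) (u +ᵥ m)
      g : Vect n → ℕ
      g u = ∑ (allVecs n) (λ m → ⟦ p m ∧ (B₊ u m ≡ᶠ 0#) ⟧)
      swapped : size p * zeros ≡ ∑ (allVecs n) g
      swapped = begin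
        size p * zeros
          ≡⟨ ∑-*ʳ (allVecs n) zeros _ ⟨
        ∑ (allVecs n) (λ m → ⟦ p m ⟧ * zeros)
          ≡⟨ ∑-cong (allVecs n) (λ m → trans (cong (⟦ p m ⟧ *_) (sym (∑-translate₁ m (λ v → ⟦ B v v ≡ᶠ 0# ⟧))))
               (trans (sym (∑-*ˡ (allVecs n) ⟦ p m ⟧ _)) (∑-cong (allVecs n) λ u → sym (⟦⟧-∧ (p m) _)))) ⟩
        ∑ (allVecs n) (λ m → ∑ (allVecs n) (λ u → ⟦ p m ∧ (B₊ u m ≡ᶠ 0#) ⟧))
          ≡⟨ ∑-swap (allVecs n) (allVecs n) _ ⟩
        ∑ (allVecs n) g ∎
      f : Vect n → Vect n → Carrier
      f u m = (1# ⊕ 1#) ⊗ B m u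
      f-linear : ∀ u → Linear (f u)
      f-linear u = record
        { f-add  = λ v w → trans (cong ((1# ⊕ 1#) ⊗_) (addˡ v w u)) (distribˡ _ _ _)
        ; f-smul = λ c v → trans (cong ((1# ⊕ 1#) ⊗_) (smulˡ c v u))
            (trans (sym (⊗-assoc _ c _)) (trans (cong (_⊗ B v u) (⊗-comm _ c)) (⊗-assoc c _ _)))
        }
      affine : ∀ u m → T (p m) → B₊ u m ≡ B u u ⊕ f u m
      affine u m pm = begin
        B₊ u m                                  ≡⟨ trans (addˡ _ _ _) (cong₂ _⊕_ (addʳ _ _ _) (addʳ _ _ _)) ⟩
        (B u u ⊕ B u m) ⊕ (B m u ⊕ B m m)       ≡⟨ cong₂ _⊕_ (cong (B u u ⊕_) (symm u m)) (trans (cong (B m u ⊕_) (iso m m pm pm)) (⊕-identityʳ _)) ⟩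
        (B u u ⊕ B m u) ⊕ B m u                 ≡⟨ ⊕-assoc _ _ _ ⟩
        B u u ⊕ (B m u ⊕ B m u)                 ≡⟨ cong (B u u ⊕_) (trans (distribʳ _ _ _) (cong₂ _⊕_ (⊗-identityˡ _) (⊗-identityˡ _))) ⟨
        B u u ⊕ f u m                           ∎
      -- If u is orthogonal to `p`, then `B₊ u` is constant on `p` and all of `p` or nothing is
      -- counted. Otherwise `f u` takes every value on a q-th part of `p`, so `q * g u` is `size p`.
      row : ∀ u → q * g u + size p * ⟦ perp B p u ⟧ ≡ q * size p * ⟦ singular B p u ⟧ + size p
      row u with T-dec (perp B p u)
      ... | inj₁ u⊥ = begin
        q * g u + size p * ⟦ perp B p u ⟧
          ≡⟨ cong₂ (λ a b → q * a + size p * b)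
               (trans (∑-cong (allVecs n) λ m → trans (cong ⟦_⟧ (bool-ext
                   (λ t → ∧⁺ (proj₁ (∧⁻ t)) (≡ᶠ⁺ (trans (sym (same m (proj₁ (∧⁻ t)))) (≡ᶠ⁻ (proj₂ (∧⁻ t))))))
                   (λ t → ∧⁺ (proj₁ (∧⁻ t)) (≡ᶠ⁺ (trans (same m (proj₁ (∧⁻ t))) (≡ᶠ⁻ (proj₂ (∧⁻ {p m} t))))))))
                 (⟦⟧-∧ (p m) (B u u ≡ᶠ 0#))) (∑-*ʳ (allVecs n) _ _))
               (⟦⟧-true u⊥) ⟩
        q * (size p * ⟦ B u u ≡ᶠ 0# ⟧) + size p * 1
          ≡⟨ lemma₃ q (size p) _ ⟩
        q * size p * ⟦ B u u ≡ᶠ 0# ⟧ + size p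
          ≡⟨ cong (λ z → q * size p * ⟦ z ⟧ + size p) (bool-ext (∧⁺ u⊥) (proj₂ ∘ ∧⁻)) ⟩
        q * size p * ⟦ singular B p u ⟧ + size p ∎
        where
        same : ∀ m → T (p m) → B₊ u m ≡ B u u
        same m pm = trans (affine u m pm) (trans (cong (B u u ⊕_) (trans (cong ((1# ⊕ 1#) ⊗_) (perp⁻ B p u⊥ m pm)) (zeroʳ _))) (⊕-identityʳ _))
      ... | inj₂ ¬u⊥ = let m , pm , Bmu≢0 = ¬perp B p ¬u⊥ in begin
        q * g u + size p * ⟦ perp B p u ⟧
          ≡⟨ cong₂ (λ a b → q * a + size p * b)
               (∑-cong (allVecs n) λ m → cong ⟦_⟧ (bool-ext
                   (λ t → ∧⁺ (proj₁ (∧⁻ t)) (≡ᶠ⁺ (+-inverseʳ-unique _ _ (trans (sym (affine u m (proj₁ (∧⁻ t)))) (≡ᶠ⁻ (proj₂ (∧⁻ t)))))))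
                   (λ t → ∧⁺ (proj₁ (∧⁻ t)) (≡ᶠ⁺ (trans (affine u m (proj₁ (∧⁻ t))) (trans (cong (B u u ⊕_) (≡ᶠ⁻ (proj₂ (∧⁻ {p m} t)))) (-‿inverseʳ _)))))))
               (⟦⟧-false ¬u⊥) ⟩
        q * ∑ (allVecs n) (λ m → ⟦ p m ∧ (f u m ≡ᶠ (⊖ (B u u))) ⟧) + size p * 0
          ≡⟨ cong (_+ size p * 0) (fibre-size s (f-linear u) pm (Bmu≢0 ∘ 2≢0-cancel) (⊖ (B u u))) ⟩
        size p + size p * 0
          ≡⟨ lemma₄ q (size p) ⟩
        q * size p * 0 + size p
          ≡⟨ cong (λ z → q * size p * z + size p) (⟦⟧-false (¬u⊥ ∘ proj₁ ∘ ∧⁻)) ⟨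
        q * size p * ⟦ singular B p u ⟧ + size p ∎

    -- At `L` the identity `zeros-perp` has N(L) = q^d, by `maximal`, and ∣L^⊥∣ = q^(d+1), which
    -- leaves q·`zeros` = q^n. It then reads q·N(p) = ∣p^⊥∣ for every isotropic `p`; multiplying by
    -- ∣p∣ and using `perp-size` gives q·∣p∣·N(p) = q^n.
    orthogonal-balanced : ∀ {d} → n ≡ 2 * d + 1 → ∀ {L} → Sub L → Isotropic B L → size L ≡ q ^ d → Balanced B (q ^ (2 * d))
    orthogonal-balanced {d} n≡ {L} sL isoL ∣L∣ = record
      { bil       = bil
      ; reflexive = λ u v e → trans (symm v u) e
      ; balance   = balance
      }
      where
      instance
        q-nonZero : NonZero q
        q-nonZero = >-nonZero q>0
        qᵈ-nonZero : NonZero (q ^ d)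
        qᵈ-nonZero = m^n≢0 q d
      qⁿ : q ^ n ≡ q * q ^ (2 * d)
      qⁿ = cong (q ^_) (trans n≡ (+-comm (2 * d) 1))
      qⁿ′ : q ^ n ≡ q ^ d * (q * q ^ d)
      qⁿ′ = trans (cong (q ^_) (trans n≡ (2d+1 d))) (^-distribˡ-+-* q d (suc d))
        where
        2d+1 : ∀ d → 2 * d + 1 ≡ d + suc d
        2d+1 = solve-∀
      ∣L⊥∣ : size (perp B L) ≡ q * q ^ d
      ∣L⊥∣ = *-cancelˡ-≡ _ _ (q ^ d) (trans (cong (_* size (perp B L)) (sym ∣L∣)) (trans (perp-size bil nondeg sL) qⁿ′))
      -- A larger isotropic subspace M would satisfy ∣M∣² > ∣M∣ ∣M^⊥∣.
      maximal : ∀ v → T (singular B L v) → T (L v)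
      maximal v t with T-dec (L v)
      ... | inj₁ Lv  = Lv
      ... | inj₂ ¬Lv = ⊥-elim (<⇒≱ {q ^ d * (q * q ^ d)} {(q * q ^ d) * (q * q ^ d)}
          (*-monoˡ-< (q * q ^ d) {{m*n≢0 q (q ^ d)}} (m<m*n′ (q ^ d)))
          (≤-trans (≤-reflexive (cong₂ _*_ (sym ∣M∣) (sym ∣M∣)))
            (≤-trans (*-monoʳ-≤ (size M) (size-mono λ w Mw → perp⁺ B M λ u Mu → isoM u w Mu Mw))
              (≤-reflexive (trans (perp-size bil nondeg sM) qⁿ′)))))
        where
        M = adjoin L v
        sM = adjoin-sub sL v
        isoM : Isotropic B M
        isoM = adjoin-isotropic bil (λ u w e → trans (symm w u) e) isoL t
        ∣M∣ : size M ≡ q * q ^ d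
        ∣M∣ = trans (adjoin-size sL v ¬Lv) (cong (q *_) ∣L∣)
        m<m*n′ : ∀ m → .{{NonZero m}} → m < q * m
        m<m*n′ m = subst (m <_) (*-comm m q) (m<m*n m q 2≤q)
      zeros≡ : q * zeros ≡ q ^ n
      zeros≡ = +-cancelˡ-≡ (q * q ^ d) _ _ (begin
        q * q ^ d + q * zeros                      ≡⟨ +-comm (q * q ^ d) _ ⟩
        q * zeros + q * q ^ d                      ≡⟨ cong (q * zeros +_) ∣L⊥∣ ⟨
        q * zeros + size (perp B L)                ≡⟨ zeros-perp sL isoL ⟩
        q * size (singular B L) + q ^ n            ≡⟨ cong (λ z → q * z + q ^ n) (trans (∑-cong (allVecs n) λ v →
                                                        cong ⟦_⟧ (bool-ext (maximal v) (isotropic⇒singular isoL v))) ∣L∣) ⟩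
        q * q ^ d + q ^ n                          ∎)
      balance : ∀ {p} → Sub p → Isotropic B p → size p * size (singular B p) ≡ q ^ (2 * d)
      balance {p} s iso = *-cancelˡ-≡ _ _ q (begin
        q * (size p * size (singular B p))         ≡⟨ lemma q (size p) _ ⟩
        size p * (q * size (singular B p))         ≡⟨ cong (size p *_) (+-cancelʳ-≡ (q ^ n) _ _ (trans (sym (zeros-perp s iso)) (trans (cong (_+ size (perp B p)) zeros≡) (+-comm (q ^ n) _)))) ⟩
        size p * size (perp B p)                   ≡⟨ perp-size bil nondeg s ⟩
        q ^ n                                      ≡⟨ qⁿ ⟩
        q * q ^ (2 * d)                            ∎)
        where
        lemma : ∀ a b c → a * (b * c) ≡ b * (a * c)
        lemma = solve-∀

  Sub-cong : ∀ {n} {p r : Vect n → Bool} → (∀ v → p v ≡ r v) → Sub p → Sub r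
  Sub-cong {p = p} {r} e s = record
    { zero∈ = to (zero∈ s)
    ; add   = λ hu hv → to (add s (from hu) (from hv))
    ; smul  = λ c hu → to (smul s c (from hu))
    }
    where
    to : ∀ {v} → T (p v) → T (r v)
    to {v} = subst T (e v)
    from : ∀ {v} → T (r v) → T (p v)
    from {v} = subst T (sym (e v))

  zero-sub : ∀ {n} → Sub {n} (_≡ᵛ 0ᵥ)
  zero-sub = record
    { zero∈ = ≡ᵛ⁺ refl
    ; add   = λ hu hv → ≡ᵛ⁺ (trans (cong₂ _+ᵥ_ (≡ᵛ⁻ hu) (≡ᵛ⁻ hv)) (+ᵥ-identityˡ 0ᵥ))
    ; smul  = λ c hu → ≡ᵛ⁺ (trans (cong (c ·ᵥ_) (≡ᵛ⁻ hu)) (·ᵥ-zeroʳ c))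
    }

  zero-size : ∀ {n} → size {n} (_≡ᵛ 0ᵥ) ≡ 1
  zero-size {n} = ∑-unique (_≡ᵛ 0ᵥ) (allVecs-unique n) (∈-allVecs 0ᵥ) (≡ᵛ⁺ refl) (λ _ → ≡ᵛ⁻)

  -- Subsets as masks

  select-⊆ : ∀ {A : Set} (xs : List A) bs {x} → x ∈ select xs bs → x ∈ xs
  select-⊆ (x ∷ xs) (true  ∷ bs) (here e)   = here e
  select-⊆ (x ∷ xs) (true  ∷ bs) (there x∈) = there (select-⊆ xs bs x∈)
  select-⊆ (x ∷ xs) (false ∷ bs) x∈         = there (select-⊆ xs bs x∈)

  ∈-select⁺ : ∀ {A : Set} (p : A → Bool) xs {x} → x ∈ xs → T (p x) →
              x ∈ select xs (toList (V.map p (fromList xs)))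
  ∈-select⁺ p (y ∷ xs) x∈ px with p y in eq | x∈
  ... | true  | here e    = here e
  ... | true  | there x∈′ = there (∈-select⁺ p xs x∈′ px)
  ... | false | here refl = ⊥-elim (subst T eq px)
  ... | false | there x∈′ = ∈-select⁺ p xs x∈′ px

  ∈-select⁻ : ∀ {A : Set} (p : A → Bool) xs {x} → x ∈ select xs (toList (V.map p (fromList xs))) → T (p x)
  ∈-select⁻ p (y ∷ xs) x∈ with p y in eq | x∈
  ... | true  | here refl = subst T (sym eq) _
  ... | true  | there x∈′ = ∈-select⁻ p xs x∈′
  ... | false | x∈′       = ∈-select⁻ p xs x∈′

  -- Without repetitions in `xs`, every bit can be read off from membership. Masks are therefore
  -- canonical, and the inverse laws of the final bijection can be proved as equalities of subsets.
  select-injective : ∀ {A : Set} {xs : List A} → Unique xs → (bs cs : Vec Bool (length xs)) →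
    (∀ x → x ∈ select xs (toList bs) → x ∈ select xs (toList cs)) →
    (∀ x → x ∈ select xs (toList cs) → x ∈ select xs (toList bs)) → bs ≡ cs
  select-injective {xs = []}     u []       []       f g = refl
  select-injective {xs = x ∷ xs} (x∉ ∷ u) (b ∷ bs) (c ∷ cs) f g with b | c
  ... | true  | true  = cong (true ∷_) (select-injective u bs cs
    (λ y y∈ → tail (select-⊆ xs _ y∈) (f y (there y∈))) (λ y y∈ → tail (select-⊆ xs _ y∈) (g y (there y∈))))
    where
    tail : ∀ {y zs} → y ∈ xs → y ∈ x ∷ zs → y ∈ zs
    tail y∈ (here refl) = ⊥-elim (All.lookup x∉ y∈ refl)
    tail y∈ (there y∈′) = y∈′
  ... | true  | false = ⊥-elim (All.lookup x∉ (select-⊆ xs _ (f x (here refl))) refl)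
  ... | false | true  = ⊥-elim (All.lookup x∉ (select-⊆ xs _ (g x (here refl))) refl)
  ... | false | false = cong (false ∷_) (select-injective u bs cs f g)

  ∈ˢ⁺ : ∀ {n} {v : Vect n} (S : Subset n) → v ∈ members S → T (v ∈ˢ S)
  ∈ˢ⁺ {v = v} S v∈ = any-∈⁺ (_≡ᵛ v) (members S) v v∈ (≡ᵛ⁺ refl)

  ∈ˢ⁻ : ∀ {n} {v : Vect n} (S : Subset n) → T (v ∈ˢ S) → v ∈ members S
  ∈ˢ⁻ {v = v} S t = let u , u∈ , e = any-∈⁻ (_≡ᵛ v) (members S) t in subst (_∈ members S) (≡ᵛ⁻ e) u∈

  ⟪_⟫ : ∀ {n} → Subset n → Vect n → Bool
  ⟪ S ⟫ v = v ∈ˢ S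

  Subset-ext : ∀ {n} (S S′ : Subset n) → (∀ v → T (v ∈ˢ S) → T (v ∈ˢ S′)) → (∀ v → T (v ∈ˢ S′) → T (v ∈ˢ S)) → S ≡ S′
  Subset-ext {n} S S′ f g = cong mask (select-injective (allVecs-unique n) (bits S) (bits S′)
    (λ v v∈ → ∈ˢ⁻ S′ (f v (∈ˢ⁺ S v∈))) (λ v v∈ → ∈ˢ⁻ S (g v (∈ˢ⁺ S′ v∈))))

  fromPred : ∀ {n} → (Vect n → Bool) → Subset n
  fromPred {n} p = mask (V.map p (fromList (allVecs n)))

  ∈-fromPred : ∀ {n} (p : Vect n → Bool) v → ⟪ fromPred p ⟫ v ≡ p v
  ∈-fromPred {n} p v = bool-ext (λ t → ∈-select⁻ p (allVecs n) (∈ˢ⁻ (fromPred p) t))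
    (λ pv → ∈ˢ⁺ (fromPred p) (∈-select⁺ p (allVecs n) (∈-allVecs v) pv))

  fromPred-size : ∀ {n} (p : Vect n → Bool) → size ⟪ fromPred p ⟫ ≡ size p
  fromPred-size {n} p = ∑-cong (allVecs n) λ v → cong ⟦_⟧ (∈-fromPred p v)

  fromPred-sub : ∀ {n} {p : Vect n → Bool} → Sub p → Sub ⟪ fromPred p ⟫
  fromPred-sub {p = p} = Sub-cong λ v → sym (∈-fromPred p v)

  fromPred-isotropic : ∀ {n} {B : Form n} {p} → Isotropic B p → Isotropic B ⟪ fromPred p ⟫
  fromPred-isotropic {p = p} iso u v hu hv = iso u v (subst T (∈-fromPred p u) hu) (subst T (∈-fromPred p v) hv)

  allSubsets : ∀ n → List (Subset n)
  allSubsets n = map mask (tuples (true ∷ false ∷ []) (length (allVecs n)))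

  allSubsets-unique : ∀ n → Unique (allSubsets n)
  allSubsets-unique n = Unique.map⁺ (cong bits) (tuples-unique (((λ ()) ∷ []) ∷ [] ∷ []) _)

  ∈-allSubsets : ∀ {n} (S : Subset n) → S ∈ allSubsets n
  ∈-allSubsets (mask bs) = ∈-map⁺ mask (∈-tuples⁺ (VAll.universal bit bs))
    where
    bit : ∀ b → b ∈ true ∷ false ∷ []
    bit true  = here refl
    bit false = there (here refl)

  _≡ˢ_ : ∀ {n} → Subset n → Subset n → Bool
  S ≡ˢ S′ = ⌊ VP.≡-dec _≟ᵇ_ (bits S) (bits S′) ⌋

  ≡ˢ⁻ : ∀ {n} {S S′ : Subset n} → T (S ≡ˢ S′) → S ≡ S′
  ≡ˢ⁻ t = cong mask (toWitness t)

  ≡ˢ-refl : ∀ {n} (S : Subset n) → T (S ≡ˢ S)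
  ≡ˢ-refl S = fromWitness refl

  ⊆ˢ⁺ : ∀ {n} (S S′ : Subset n) → (∀ v → T (v ∈ˢ S) → T (v ∈ˢ S′)) → T (S ⊆ˢ S′)
  ⊆ˢ⁺ S S′ h = all-∈⁺ _ (members S) λ v v∈ → h v (∈ˢ⁺ S v∈)

  ⊆ˢ⁻ : ∀ {n} (S S′ : Subset n) → T (S ⊆ˢ S′) → ∀ v → T (v ∈ˢ S) → T (v ∈ˢ S′)
  ⊆ˢ⁻ S S′ t v h = all-∈⁻ _ (members S) t v (∈ˢ⁻ S h)

  isSubspace⁺ : ∀ {n} (S : Subset n) → Sub ⟪ S ⟫ → T (isSubspace S)
  isSubspace⁺ S s = ∧⁺ (zero∈ s) (∧⁺
    (all-∈⁺ _ (members S) λ u u∈ → all-∈⁺ _ (members S) λ v v∈ → add s (∈ˢ⁺ S u∈) (∈ˢ⁺ S v∈))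
    (all-∈⁺ _ elements λ c _ → all-∈⁺ _ (members S) λ u u∈ → smul s c (∈ˢ⁺ S u∈)))

  isSubspace⁻ : ∀ {n} (S : Subset n) → T (isSubspace S) → Sub ⟪ S ⟫
  isSubspace⁻ S t = let z , rest = ∧⁻ t ; a , m = ∧⁻ rest in record
    { zero∈ = z
    ; add   = λ {u} {v} hu hv → all-∈⁻ _ (members S) (all-∈⁻ _ (members S) a u (∈ˢ⁻ S hu)) v (∈ˢ⁻ S hv)
    ; smul  = λ c {u} hu → all-∈⁻ _ (members S) (all-∈⁻ _ elements m c (elements-complete c)) u (∈ˢ⁻ S hu)
    }

  isIsotropic⁺ : ∀ {n} {B : Form n} (S : Subset n) → Isotropic B ⟪ S ⟫ → T (isIsotropic B S)
  isIsotropic⁺ S iso = all-∈⁺ _ (members S) λ u u∈ → all-∈⁺ _ (members S) λ v v∈ → ≡ᶠ⁺ (iso u v (∈ˢ⁺ S u∈) (∈ˢ⁺ S v∈))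

  isIsotropic⁻ : ∀ {n} {B : Form n} (S : Subset n) → T (isIsotropic B S) → Isotropic B ⟪ S ⟫
  isIsotropic⁻ S t u v hu hv = ≡ᶠ⁻ (all-∈⁻ _ (members S) (all-∈⁻ _ (members S) t u (∈ˢ⁻ S hu)) v (∈ˢ⁻ S hv))

  -- Dimension

  span : ∀ {n k} → Vec (Vect n) k → Vect n → Bool
  span []       = _≡ᵛ 0ᵥ
  span (v ∷ vs) = adjoin (span vs) v

  span-sub : ∀ {n k} (vs : Vec (Vect n) k) → Sub (span vs)
  span-sub []       = zero-sub
  span-sub (v ∷ vs) = adjoin-sub (span-sub vs) v

  span-least : ∀ {n k} {p : Vect n → Bool} → Sub p → {vs : Vec (Vect n) k} → VAll.All (T ∘ p) vs →
               ∀ x → T (span vs x) → T (p x)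
  span-least {p = p} s []       x t = subst (T ∘ p) (sym (≡ᵛ⁻ t)) (zero∈ s)
  span-least s (h ∷ hs) = adjoin-least s (span-least s hs) h

  lincomb∈span : ∀ {n k} (cs : Vec Carrier k) (vs : Vec (Vect n) k) → T (span vs (lincomb cs vs))
  lincomb∈span []       []       = ≡ᵛ⁺ refl
  lincomb∈span (c ∷ cs) (v ∷ vs) = add s (smul s c (adjoin-∋ (span-sub vs) v)) (adjoin-⊇ (span-sub vs) v (lincomb∈span cs vs))
    where s = span-sub (v ∷ vs)

  span⇒lincomb : ∀ {n k} (vs : Vec (Vect n) k) x → T (span vs x) → ∃ λ cs → lincomb cs vs ≡ x
  span⇒lincomb []       x t = [] , sym (≡ᵛ⁻ t)
  span⇒lincomb (v ∷ vs) x t =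
    let c , h = adjoin⁻ (span vs) v x t
        cs , e = span⇒lincomb vs _ h
    in (⊖ c) ∷ cs , trans (+ᵥ-comm _ _) (trans (cong (_+ᵥ ((⊖ c) ·ᵥ v)) e) (add-sub x c v))

  -- Independence in incremental form: each vector avoids the span of those after it. One use of
  -- `adjoin-size` per vector then gives the size of the span.
  data Independent {n} : ∀ {k} → Vec (Vect n) k → Set where
    []  : Independent []
    _∷_ : ∀ {k v} {vs : Vec (Vect n) k} → ¬ T (span vs v) → Independent vs → Independent (v ∷ vs)

  span-size : ∀ {n k} {vs : Vec (Vect n) k} → Independent vs → size (span vs) ≡ q ^ k
  span-size {n} []    = zero-size {n}
  span-size (_∷_ {v = v} {vs} v∉ i) = trans (adjoin-size (span-sub vs) v v∉) (cong (q *_) (span-size i))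

  Trivial : ∀ {n k} → Vec (Vect n) k → Set
  Trivial vs = ∀ cs → lincomb cs vs ≡ 0ᵥ → cs ≡ 0ᵥ

  trivial⇒independent : ∀ {n k} (vs : Vec (Vect n) k) → Trivial vs → Independent vs
  trivial⇒independent []       h = []
  trivial⇒independent (v ∷ vs) h = v∉ ∷ trivial⇒independent vs λ cs e →
    VP.∷-injectiveʳ (h (0# ∷ cs) (trans (cong₂ _+ᵥ_ (·ᵥ-zeroˡ v) e) (+ᵥ-identityˡ 0ᵥ)))
    where
    v∉ : ¬ T (span vs v)
    v∉ t with span⇒lincomb vs v t
    -- If `v` were the combination `cs` of `vs`, the relation with head `⊖ 1#` would vanish, and
    -- triviality would force `⊖ 1#` to be 0.
    ... | cs , e = 0≢1 (trans (sym -0#≈0#) (trans (cong ⊖_ (sym (VP.∷-injectiveˡ (h ((⊖ 1#) ∷ cs)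
      (trans (cong (((⊖ 1#) ·ᵥ v) +ᵥ_) (trans e (sym (·ᵥ-identity v)))) (cancel-⊖′ 1# v)))))) (-‿involutive 1#)))

  independent⇒trivial : ∀ {n k} {vs : Vec (Vect n) k} → Independent vs → Trivial vs
  independent⇒trivial []       [] e = refl
  independent⇒trivial (_∷_ {v = v} {vs} v∉ i) (c ∷ cs) e with c ≟ 0#
  ... | yes refl = cong (0# ∷_) (independent⇒trivial i cs
    (trans (sym (trans (cong (_+ᵥ lincomb cs vs) (·ᵥ-zeroˡ v)) (+ᵥ-identityˡ _))) e))
  ... | no c≢0 = ⊥-elim (v∉ (unscale s c≢0 (sub-cancel s {c = 1#} {v = lincomb cs vs}
    (subst (T ∘ span vs) (sym (trans (cong ((c ·ᵥ v) +ᵥ_) (·ᵥ-identity _)) e)) (zero∈ s)) (lincomb∈span cs vs))))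
    where s = span-sub vs

  linIndep⁻ : ∀ {n k} (vs : Vec (Vect n) k) → T (linIndep vs) → Independent vs
  linIndep⁻ {k = k} vs t = trivial⇒independent vs λ cs e → case cs e (all-∈⁻ _ (allVecs k) t cs (∈-allVecs cs))
    where
    case : ∀ cs → lincomb cs vs ≡ 0ᵥ → T (not (lincomb cs vs ≡ᵛ 0ᵥ) ∨ (cs ≡ᵛ 0ᵥ)) → cs ≡ 0ᵥ
    case cs e t with lincomb cs vs ≡ᵛ 0ᵥ | ≡ᵛ⁺ e
    ... | true | _ = ≡ᵛ⁻ t

  linIndep⁺ : ∀ {n k} {vs : Vec (Vect n) k} → Independent vs → T (linIndep vs)
  linIndep⁺ {k = k} {vs} i = all-∈⁺ _ (allVecs k) λ cs _ → case cs
    where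
    case : ∀ cs → T (not (lincomb cs vs ≡ᵛ 0ᵥ) ∨ (cs ≡ᵛ 0ᵥ))
    case cs with lincomb cs vs ≡ᵛ 0ᵥ in eq
    ... | true  = ≡ᵛ⁺ (independent⇒trivial i cs (≡ᵛ⁻ (subst T (sym eq) _)))
    ... | false = _

  q^-cancel-≤ : ∀ a b → q ^ a ≤ q ^ b → a ≤ b
  q^-cancel-≤ a b h = ≮⇒≥ λ b<a → <⇒≱ (^-monoʳ-< q 2≤q b<a) h

  independent-≤ : ∀ {n k} {p : Vect n → Bool} → Sub p → {vs : Vec (Vect n) k} → VAll.All (T ∘ p) vs →
                  Independent vs → q ^ k ≤ size p
  independent-≤ s hs i = subst (_≤ _) (span-size i) (size-mono (span-least s hs))

  -- A family inside `p` is enlarged greedily until its span exhausts `p`. The fuel `f` keeps n < k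
  -- + f; when it runs out, k exceeds n, which contradicts q^k ≤ ∣p∣ ≤ q^n.
  basis : ∀ {n} {p : Vect n → Bool} → Sub p →
          ∃ λ k → Σ (Vec (Vect n) k) λ vs → VAll.All (T ∘ p) vs × Independent vs × size p ≡ q ^ k
  basis {n} {p} s = extend (suc n) [] [] ≤-refl
    where
    extend : ∀ f {k} {vs : Vec (Vect n) k} → VAll.All (T ∘ p) vs → Independent vs → n < k + f →
             ∃ λ k → Σ (Vec (Vect n) k) λ vs → VAll.All (T ∘ p) vs × Independent vs × size p ≡ q ^ k
    extend zero {k} hs i n<k = ⊥-elim (<⇒≱ (subst (n <_) (+-identityʳ k) n<k)
      (q^-cancel-≤ k n (≤-trans (independent-≤ s hs i) (size≤ p))))
    extend (suc f) {k} {vs} hs i n< with all-or-counterexample (λ v → not (p v) ∨ span vs v) (allVecs n)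
    ... | inj₁ h = k , vs , hs , i , trans (≤-antisym (size-mono λ v pv → or v pv (h v (∈-allVecs v))) (size-mono (span-least s hs))) (span-size i)
      where
      or : ∀ v → T (p v) → T (not (p v) ∨ span vs v) → T (span vs v)
      or v pv t with p v
      ... | true = t
    ... | inj₂ (v , _ , h) = extend f (proj₁ (nor h) ∷ hs) (proj₂ (nor h) ∷ i) (subst (n <_) (+-suc k f) n<)
      where
      nor : ¬ T (not (p v) ∨ span vs v) → T (p v) × ¬ T (span vs v)
      nor h with p v
      ... | true  = _ , h
      ... | false = ⊥-elim (h _)

  -- A basis of length k shows that k is attained in the search defining `dim`, and an independent
  -- family of length j in `S` has q^j ≤ ∣S∣ = q^k. This is the passage from sizes back to the
  -- dimensions that occur in `weight`.
  size≡q^dim : ∀ {n} (S : Subset n) → Sub ⟪ S ⟫ → size ⟪ S ⟫ ≡ q ^ dim S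
  size≡q^dim {n} S s with basis s
  ... | k , vs , hs , i , e = trans e (cong (q ^_) (sym (foldr-max (hasIndep S) (upTo (suc n)) k
      (∈-upTo⁺ (s≤s (q^-cancel-≤ k n (subst (_≤ q ^ n) e (size≤ ⟪ S ⟫)))))
      (any-∈⁺ linIndep _ vs (∈-tuples⁺ (VAll.map (∈ˢ⁻ S) hs)) (linIndep⁺ i))
      bound)))
    where
    bound : ∀ j → j ∈ upTo (suc n) → T (hasIndep S j) → j ≤ k
    bound j _ t = let us , us∈ , ind = any-∈⁻ linIndep _ t in
      q^-cancel-≤ j k (subst (q ^ j ≤_) e (independent-≤ s (VAll.map (∈ˢ⁺ S) (∈-tuples⁻ j us∈)) (linIndep⁻ us ind)))

  size≡⇒dim≡ : ∀ {n n′} (S : Subset n) (S′ : Subset n′) → Sub ⟪ S ⟫ → Sub ⟪ S′ ⟫ → size ⟪ S ⟫ ≡ size ⟪ S′ ⟫ → dim S ≡ dim S′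
  size≡⇒dim≡ S S′ s s′ e = ≤-antisym (q^-cancel-≤ _ _ (≤-reflexive e′)) (q^-cancel-≤ _ _ (≤-reflexive (sym e′)))
    where
    e′ : q ^ dim S ≡ q ^ dim S′
    e′ = trans (sym (size≡q^dim S s)) (trans e (size≡q^dim S′ s′))

  -- Isotropic subspaces above a given one

  record IsotropicSubspace {n} (B : Form n) (S : Subset n) : Set where
    constructor _,_
    field
      subspace  : Sub ⟪ S ⟫
      isotropic : Isotropic B ⟪ S ⟫
  open IsotropicSubspace

  -- Extensions are graded by their number of vectors instead of their dimension, so that counting
  -- applies directly. The Boolean form is what gets summed; `Extends` is its propositional reading.
  extends : ∀ {n} → Form n → Subset n → ℕ → Subset n → Bool
  extends B S t U = (isSubspace U ∧ isIsotropic B U) ∧ ((S ⊆ˢ U) ∧ (size ⟪ U ⟫ ≡ᵇ t))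

  record Extends {n} (B : Form n) (S : Subset n) (t : ℕ) (U : Subset n) : Set where
    constructor mkExtends
    field
      isoSub : IsotropicSubspace B U
      above  : ∀ v → T (v ∈ˢ S) → T (v ∈ˢ U)
      size≡  : size ⟪ U ⟫ ≡ t
  open Extends

  extends⁺ : ∀ {n} {B : Form n} {S t U} → Extends B S t U → T (extends B S t U)
  extends⁺ {S = S} {t} {U} (mkExtends (s , i) h e) =
    ∧⁺ (∧⁺ (isSubspace⁺ U s) (isIsotropic⁺ U i)) (∧⁺ (⊆ˢ⁺ S U h) (≡⇒≡ᵇ _ t e))

  extends⁻ : ∀ {n} {B : Form n} {S t U} → T (extends B S t U) → Extends B S t U
  extends⁻ {S = S} {t} {U} x = let a , b = ∧⁻ x ; s , i = ∧⁻ a ; h , e = ∧⁻ b in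
    mkExtends (isSubspace⁻ U s , isIsotropic⁻ U i) (⊆ˢ⁻ S U h) (≡ᵇ⇒≡ _ t e)

  #extensions : ∀ {n} → Form n → Subset n → ℕ → ℕ
  #extensions {n} B S t = ∑ (allSubsets n) (λ U → ⟦ extends B S t U ⟧)

  _+⟨_⟩ : ∀ {n} → Subset n → Vect n → Subset n
  S +⟨ v ⟩ = fromPred (adjoin ⟪ S ⟫ v)

  -- The vectors whose adjunction gives a strictly larger isotropic subspace. Vectors are counted
  -- instead of the subspaces `S +⟨ v ⟩`, because different candidates can give the same subspace.
  candidate : ∀ {n} → Form n → Subset n → Vect n → Bool
  candidate B S v = not (v ∈ˢ S) ∧ singular B ⟪ S ⟫ v

  size-∖ : ∀ {n} {p r : Vect n → Bool} → (∀ v → T (p v) → T (r v)) →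
           ∑ (allVecs n) (λ v → ⟦ not (p v) ∧ r v ⟧) + size p ≡ size r
  size-∖ {n} {p} {r} h = trans (sym (∑-+ (allVecs n) _ _)) (∑-cong (allVecs n) λ v → pointwise (p v) (r v) (h v))
    where
    pointwise : ∀ a b → (T a → T b) → ⟦ not a ∧ b ⟧ + ⟦ a ⟧ ≡ ⟦ b ⟧
    pointwise true  b f = sym (⟦⟧-true (f _))
    pointwise false b f = +-identityʳ ⟦ b ⟧

  -- An extension with no more elements than `S` is `S` itself. This is the base of the induction on
  -- `t ∸ size ⟪ S ⟫`.
  small-extensions : ∀ {n} {B : Form n} {S t} → IsotropicSubspace B S → t ≤ size ⟪ S ⟫ →
                     #extensions B S t ≡ ⟦ t ≡ᵇ size ⟪ S ⟫ ⟧
  small-extensions {n} {B} {S} {t} g t≤ with T-dec (t ≡ᵇ size ⟪ S ⟫)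
  ... | inj₁ y = trans (∑-unique (extends B S t) (allSubsets-unique n) (∈-allSubsets S)
      (extends⁺ (mkExtends g (λ _ z → z) (sym (≡ᵇ⇒≡ t _ y)))) only) (sym (⟦⟧-true y))
    where
    only : ∀ U → T (extends B S t U) → U ≡ S
    only U x = let e = extends⁻ {U = U} x in
      Subset-ext U S (size-≤⇒⊇ (above e) (≤-reflexive (trans (size≡ e) (≡ᵇ⇒≡ t _ y)))) (above e)
  ... | inj₂ n′ = trans (∑-zero (allSubsets n) λ U _ → ⟦⟧-false λ x → let e = extends⁻ {U = U} x in
      n′ (≡⇒≡ᵇ t _ (≤-antisym t≤ (subst (size ⟪ S ⟫ ≤_) (size≡ e) (size-mono (above e))))))
    (sym (⟦⟧-false n′))

  module Extensions {n} {B : Form n} {K} (bal : Balanced B K) {S : Subset n} (g : IsotropicSubspace B S) where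
    open Balanced bal
    open ≡-Reasoning

    +⟨⟩-isotropicSubspace : ∀ {v} → T (candidate B S v) → IsotropicSubspace B (S +⟨ v ⟩)
    +⟨⟩-isotropicSubspace {v} c = fromPred-sub (adjoin-sub (subspace g) v)
      , fromPred-isotropic (adjoin-isotropic bil reflexive (isotropic g) (proj₂ (∧⁻ {not (v ∈ˢ S)} c)))

    +⟨⟩-size : ∀ {v} → T (candidate B S v) → size ⟪ S +⟨ v ⟩ ⟫ ≡ q * size ⟪ S ⟫
    +⟨⟩-size {v} c = trans (fromPred-size (adjoin ⟪ S ⟫ v)) (adjoin-size (subspace g) v (not⁻ (proj₁ (∧⁻ c))))

    candidates : ∑ (allVecs n) (λ v → ⟦ candidate B S v ⟧) + size ⟪ S ⟫ ≡ size (singular B ⟪ S ⟫)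
    candidates = size-∖ (isotropic⇒singular (isotropic g))

    -- Double counting of the pairs (U , v) with v ∈ U ∖ S and U an extension of S of size t.
    #extensions-rec : ∀ t → #extensions B S t * (t ∸ size ⟪ S ⟫)
                          ≡ ∑ (allVecs n) (λ v → ⟦ candidate B S v ⟧ * #extensions B (S +⟨ v ⟩) t)
    #extensions-rec t = begin
      #extensions B S t * (t ∸ size ⟪ S ⟫)
        ≡⟨ ∑-*ʳ (allSubsets n) _ _ ⟨
      ∑ (allSubsets n) (λ U → ⟦ extends B S t U ⟧ * (t ∸ size ⟪ S ⟫))
        ≡⟨ ∑-cong (allSubsets n) column ⟩
      ∑ (allSubsets n) (λ U → ∑ (allVecs n) (λ v → ⟦ extends B S t U ∧ (not (v ∈ˢ S) ∧ (v ∈ˢ U)) ⟧))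
        ≡⟨ ∑-swap (allSubsets n) (allVecs n) _ ⟩
      ∑ (allVecs n) (λ v → ∑ (allSubsets n) (λ U → ⟦ extends B S t U ∧ (not (v ∈ˢ S) ∧ (v ∈ˢ U)) ⟧))
        ≡⟨ ∑-cong (allVecs n) (λ v → trans (∑-cong (allSubsets n) λ U →
             trans (cong ⟦_⟧ (bool-ext (through v U) (back v U))) (⟦⟧-∧ (candidate B S v) _)) (∑-*ˡ (allSubsets n) ⟦ candidate B S v ⟧ _)) ⟩
      ∑ (allVecs n) (λ v → ⟦ candidate B S v ⟧ * #extensions B (S +⟨ v ⟩) t) ∎
      where
      column : ∀ U → ⟦ extends B S t U ⟧ * (t ∸ size ⟪ S ⟫)
                   ≡ ∑ (allVecs n) (λ v → ⟦ extends B S t U ∧ (not (v ∈ˢ S) ∧ (v ∈ˢ U)) ⟧)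
      column U = trans (by (T-dec (extends B S t U)))
        (trans (sym (∑-*ˡ (allVecs n) ⟦ extends B S t U ⟧ _)) (∑-cong (allVecs n) λ v → sym (⟦⟧-∧ (extends B S t U) _)))
        where
        by : T (extends B S t U) ⊎ ¬ T (extends B S t U) → ⟦ extends B S t U ⟧ * (t ∸ size ⟪ S ⟫)
             ≡ ⟦ extends B S t U ⟧ * ∑ (allVecs n) (λ v → ⟦ not (v ∈ˢ S) ∧ (v ∈ˢ U) ⟧)
        by (inj₁ x) = let e = extends⁻ {U = U} x in cong (⟦ extends B S t U ⟧ *_) (begin
          t ∸ size ⟪ S ⟫                                          ≡⟨ cong (_∸ size ⟪ S ⟫) (trans (size-∖ (above e)) (size≡ e)) ⟨
          ∑ (allVecs n) (λ v → ⟦ not (v ∈ˢ S) ∧ (v ∈ˢ U) ⟧) + size ⟪ S ⟫ ∸ size ⟪ S ⟫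
                                                                  ≡⟨ m+n∸n≡m _ (size ⟪ S ⟫) ⟩
          ∑ (allVecs n) (λ v → ⟦ not (v ∈ˢ S) ∧ (v ∈ˢ U) ⟧)       ∎)
        by (inj₂ x) = trans (cong (_* (t ∸ size ⟪ S ⟫)) (⟦⟧-false x))
          (sym (cong (_* ∑ (allVecs n) (λ v → ⟦ not (v ∈ˢ S) ∧ (v ∈ˢ U) ⟧)) (⟦⟧-false x)))
      -- Isotropy of `U` makes any of its vectors outside `S` a candidate, and for such a `v`
      -- containing both `S` and `v` amounts to containing `S +⟨ v ⟩`.
      through : ∀ v U → T (extends B S t U ∧ (not (v ∈ˢ S) ∧ (v ∈ˢ U))) → T (candidate B S v ∧ extends B (S +⟨ v ⟩) t U)
      through v U x =
        let a , b = ∧⁻ {extends B S t U} x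
            v∉S , v∈U = ∧⁻ {not (v ∈ˢ S)} b
            e = extends⁻ {U = U} a
            iso = isotropic (isoSub e)
        in ∧⁺ (∧⁺ v∉S (∧⁺ (perp⁺ B ⟪ S ⟫ λ u u∈ → iso u v (above e u u∈) v∈U) (≡ᶠ⁺ (iso v v v∈U v∈U))))
              (extends⁺ (mkExtends (isoSub e)
                (λ u u∈ → adjoin-least (subspace (isoSub e)) (above e) v∈U u (subst T (∈-fromPred (adjoin ⟪ S ⟫ v) u) u∈)) (size≡ e)))
      back : ∀ v U → T (candidate B S v ∧ extends B (S +⟨ v ⟩) t U) → T (extends B S t U ∧ (not (v ∈ˢ S) ∧ (v ∈ˢ U)))
      back v U x =
        let c , a = ∧⁻ {candidate B S v} x
            e = extends⁻ {S = S +⟨ v ⟩} {U = U} a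
            lift : ∀ u → T (adjoin ⟪ S ⟫ v u) → T (u ∈ˢ U)
            lift = λ u h → above e u (subst T (sym (∈-fromPred (adjoin ⟪ S ⟫ v) u)) h)
        in ∧⁺ (extends⁺ (mkExtends (isoSub e) (λ u u∈ → lift u (adjoin-⊇ (subspace g) v u∈)) (size≡ e)))
              (∧⁺ (proj₁ (∧⁻ c)) (lift v (adjoin-∋ (subspace g) v)))

  -- In `#extensions-rec` the summands agree by induction, since adjoining a candidate multiplies
  -- either size by `q`, and the numbers of summands agree because `K` is shared. For t > ∣S∣ the
  -- factor `t ∸ size ⟪ S ⟫` is positive and cancels. The fuel `f` bounds t - ∣S∣.
  #extensions-≡ : ∀ {n n′} {B : Form n} {B′ : Form n′} {K} → Balanced B K → Balanced B′ K →
    ∀ {S S′} → IsotropicSubspace B S → IsotropicSubspace B′ S′ → size ⟪ S ⟫ ≡ size ⟪ S′ ⟫ →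
    ∀ t → #extensions B S t ≡ #extensions B′ S′ t
  #extensions-≡ {n} {n′} {B} {B′} bal bal′ g g′ e t = go t g g′ e (m≤n+m t _)
    where
    go : ∀ f {S S′} → IsotropicSubspace B S → IsotropicSubspace B′ S′ → size ⟪ S ⟫ ≡ size ⟪ S′ ⟫ →
         t ≤ size ⟪ S ⟫ + f → #extensions B S t ≡ #extensions B′ S′ t
    go f {S} {S′} g g′ e t≤ with t ≤? size ⟪ S ⟫
    ... | yes t≤s = trans (small-extensions g t≤s)
      (trans (cong (λ z → ⟦ t ≡ᵇ z ⟧) e) (sym (small-extensions g′ (subst (t ≤_) e t≤s))))
    go zero {S} g g′ e t≤ | no t≰s = ⊥-elim (t≰s (subst (t ≤_) (+-identityʳ _) t≤))
    go (suc f) {S} {S′} g g′ e t≤ | no t≰s =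
      *-cancelʳ-≡ _ _ (t ∸ size ⟪ S ⟫) {{>-nonZero (m<n⇒0<n∸m (≰⇒> t≰s))}}
        (trans (X.#extensions-rec t) (trans (∑-weighted (allVecs n) (allVecs n′) _ _ _ _ step same)
          (sym (trans (cong (λ z → #extensions B′ S′ t * (t ∸ z)) e) (X′.#extensions-rec t)))))
      where
      module X  = Extensions bal g
      module X′ = Extensions bal′ g′
      s>0 : 1 ≤ size ⟪ S ⟫
      s>0 = size>0 (subspace g)
      step : ∀ v v′ → T (candidate B S v) → T (candidate B′ S′ v′) →
             #extensions B (S +⟨ v ⟩) t ≡ #extensions B′ (S′ +⟨ v′ ⟩) t
      step v v′ c c′ = go f (X.+⟨⟩-isotropicSubspace c) (X′.+⟨⟩-isotropicSubspace c′)
        (trans (X.+⟨⟩-size c) (trans (cong (q *_) e) (sym (X′.+⟨⟩-size c′))))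
        -- One unit of fuel is paid for by q·∣S∣ ≥ 2·∣S∣ ≥ ∣S∣ + 1.
        (≤-trans t≤ (subst (_≤ size ⟪ S +⟨ v ⟩ ⟫ + f) (sym (+-suc _ f)) (+-monoˡ-≤ f
          (subst (suc (size ⟪ S ⟫) ≤_) (sym (X.+⟨⟩-size c))
            (≤-trans (+-mono-≤ s>0 (m≤m+n _ 0)) (*-monoˡ-≤ (size ⟪ S ⟫) 2≤q))))))
      -- Equal sizes and equal products ∣S∣·N(S) give equally many singular vectors on the two
      -- sides; taking away `S` and `S′` leaves equally many candidates.
      same : ∑ (allVecs n) (λ v → ⟦ candidate B S v ⟧) ≡ ∑ (allVecs n′) (λ v → ⟦ candidate B′ S′ v ⟧)
      same = +-cancelʳ-≡ (size ⟪ S ⟫) _ _ (trans X.candidates (trans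
        (*-cancelˡ-≡ _ _ (size ⟪ S ⟫) {{>-nonZero s>0}} (trans (Balanced.balance bal (subspace g) (isotropic g))
          (trans (sym (Balanced.balance bal′ (subspace g′) (isotropic g′))) (cong (_* size (singular B′ ⟪ S′ ⟫)) (sym e)))))
        (trans (sym X′.candidates) (cong (∑ (allVecs n′) (λ v → ⟦ candidate B′ S′ v ⟧) +_) (sym e)))))

  -- Flags

  extensions : ∀ {n} → Form n → Subset n → ℕ → List (Subset n)
  extensions {n} B S t = filter (T? ∘ extends B S t) (allSubsets n)

  extensions-unique : ∀ {n} (B : Form n) S t → Unique (extensions B S t)
  extensions-unique {n} B S t = Unique.filter⁺ (T? ∘ extends B S t) (allSubsets-unique n)

  -- A weighted flag read as a strict chain of extensions above `S`, the shape that the induction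
  -- follows. Each `U` is tagged with its own size, so the size condition inside `Extends` holds by
  -- reflexivity.
  Flag : ∀ {n} → Form n → Subset n → List (Subset n × ℕ) → Set
  Flag B S []             = ⊤
  Flag B S ((U , w) ∷ fl) = (Extends B S (size ⟪ U ⟫) U × ¬ T (U ⊆ˢ S) × T (1 ≤ᵇ w)) × Flag B U fl

  -- Both lists are taken at the size of `U`, so a partner found in the second list has the size of
  -- `U`. The default `S′` is not reached when the lists have equal length and `U` occurs in the
  -- first.
  partner : ∀ {n n′} → Form n → Form n′ → Subset n → Subset n′ → Subset n → Subset n′
  partner B B′ S S′ U = match _≡ˢ_ S′ (extensions B S (size ⟪ U ⟫)) (extensions B′ S′ (size ⟪ U ⟫)) U

  transport : ∀ {n n′} → Form n → Form n′ → Subset n → Subset n′ → List (Subset n × ℕ) → List (Subset n′ × ℕ)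
  transport B B′ S S′ []             = []
  transport B B′ S S′ ((U , w) ∷ fl) = (partner B B′ S S′ U , w) ∷ transport B B′ U (partner B B′ S S′ U) fl

  module Transport {n n′} {B : Form n} {B′ : Form n′} {K} (bal : Balanced B K) (bal′ : Balanced B′ K) where

    module _ {S S′} (g : IsotropicSubspace B S) (g′ : IsotropicSubspace B′ S′) (e : size ⟪ S ⟫ ≡ size ⟪ S′ ⟫)
             {U} (x : Extends B S (size ⟪ U ⟫) U) where

      private
        U′ = partner B B′ S S′ U
        t  = size ⟪ U ⟫

        lengths : length (extensions B S t) ≡ length (extensions B′ S′ t)
        lengths = trans (length-filter-T (extends B S t) (allSubsets n))
          (trans (#extensions-≡ bal bal′ g g′ e t) (sym (length-filter-T (extends B′ S′ t) (allSubsets n′))))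

        U∈ : U ∈ extensions B S t
        U∈ = ∈-filter⁺ (T? ∘ extends B S t) (∈-allSubsets U) (extends⁺ x)

      partner-extends : Extends B′ S′ (size ⟪ U ⟫) (partner B B′ S S′ U)
      partner-extends = extends⁻ (proj₂ (∈-filter⁻ (T? ∘ extends B′ S′ t) {xs = allSubsets n′}
        (match-∈ _≡ˢ_ _≡ˢ_ ≡ˢ⁻ ≡ˢ-refl ≡ˢ⁻ ≡ˢ-refl S S′ (extensions B S t) (extensions B′ S′ t) lengths U∈)))

      partner-partner : partner B′ B S′ S (partner B B′ S S′ U) ≡ U
      -- The backward search uses the lists at the size of the partner; after this rewriting they
      -- are the same two lists with their roles exchanged.
      partner-partner rewrite size≡ partner-extends =
        match-match _≡ˢ_ _≡ˢ_ ≡ˢ⁻ ≡ˢ-refl ≡ˢ⁻ ≡ˢ-refl S S′ (extensions B S t) (extensions B′ S′ t)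
          (extensions-unique B′ S′ t) lengths U∈

      -- Strictness is a statement about sizes: if the partner were inside `S′`, then ∣U∣ ≤ ∣S′∣ =
      -- ∣S∣, and since `U` contains `S` the two would coincide.
      partner-⊈ : ¬ T (U ⊆ˢ S) → ¬ T (partner B B′ S S′ U ⊆ˢ S′)
      partner-⊈ U⊈S U′⊆S′ = U⊈S (⊆ˢ⁺ U S (size-≤⇒⊇ (above x) (subst₂ _≤_ (size≡ partner-extends) (sym e)
        (size-mono (⊆ˢ⁻ U′ S′ U′⊆S′)))))

    -- The invariant is that the two current subspaces are isotropic and equally large;
    -- `partner-extends` restores it at each step. Weights agree because equal sizes mean equal
    -- dimensions.
    transport-correct : ∀ {S S′} → IsotropicSubspace B S → IsotropicSubspace B′ S′ → size ⟪ S ⟫ ≡ size ⟪ S′ ⟫ →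
      ∀ fl → Flag B S fl →
      Flag B′ S′ (transport B B′ S S′ fl) × weight (transport B B′ S S′ fl) ≡ weight fl ×
      transport B′ B S′ S (transport B B′ S S′ fl) ≡ fl
    transport-correct g g′ e [] _ = _ , refl , refl
    transport-correct {S} {S′} g g′ e ((U , w) ∷ fl) ((x , U⊈S , w>0) , h) =
      let x′ = partner-extends g g′ e x
          U′ = partner B B′ S S′ U
          h′ , wt , inv = transport-correct (isoSub x) (isoSub x′) (sym (size≡ x′)) fl h
      in ((subst (λ t → Extends B′ S′ t U′) (sym (size≡ x′)) x′ , partner-⊈ g g′ e x U⊈S , w>0) , h′)
       , cong₂ (λ a b → w * a + b) (size≡⇒dim≡ U′ U (subspace (isoSub x′)) (subspace (isoSub x)) (size≡ x′)) wt
       -- Backward transport continues above the partner of the partner, which has to become `U`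
       -- before the induction hypothesis `inv` applies.
       , trans (cong (λ z → (z , w) ∷ transport B′ B U′ z (transport B B′ U U′ fl)) (partner-partner g g′ e x))
           (cong ((U , w) ∷_) inv)

  -- Weighted flags as strict chains above the zero subspace

  strictChainFrom⇒strictChain : ∀ {n} {S : Subset n} fl → T (strictChainFrom S fl) → T (strictChain fl)
  strictChainFrom⇒strictChain []             _ = _
  strictChainFrom⇒strictChain {S = S} ((U , w) ∷ fl) t = proj₂ (∧⁻ {S ⊂ˢ U} t)

  flag⁻ : ∀ {n} {B : Form n} {S} fl → T (isWeightedFlag B fl) → T (strictChainFrom S fl) → Flag B S fl
  flag⁻ [] _ _ = _
  flag⁻ {S = S} ((U , w) ∷ fl) h c =
    let hs , cU   = ∧⁻ h
        hd , tl   = ∧⁻ hs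
        good , w>0 = ∧⁻ hd
        s , rest  = ∧⁻ {isSubspace U} good
        lt , c′   = ∧⁻ {S ⊂ˢ U} c
        S⊆U , U⊈S = ∧⁻ {S ⊆ˢ U} lt
    in (mkExtends (isSubspace⁻ U s , isIsotropic⁻ U (proj₁ (∧⁻ rest))) (⊆ˢ⁻ S U S⊆U) refl , not⁻ U⊈S , w>0)
       , flag⁻ fl (∧⁺ tl (strictChainFrom⇒strictChain fl c′)) c′

  -- Nonzeroness of each member comes from strictness: a vector of `U` outside the subspace `S` is
  -- not 0, since `S` contains 0.
  flag⁺ : ∀ {n} {B : Form n} {S} → Sub ⟪ S ⟫ → ∀ fl → Flag B S fl → T (isWeightedFlag B fl) × T (strictChainFrom S fl)
  flag⁺ s [] _ = _ , _
  flag⁺ {B = B} {S} s ((U , w) ∷ fl) ((x , U⊈S , w>0) , h) =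
    let rec , c = flag⁺ (subspace (isoSub x)) fl h
    in ∧⁺ (∧⁺ (∧⁺ (∧⁺ (isSubspace⁺ U (subspace (isoSub x))) (∧⁺ (isIsotropic⁺ U (isotropic (isoSub x))) nonzero)) w>0) (proj₁ (∧⁻ rec))) c
     , ∧⁺ (∧⁺ (⊆ˢ⁺ S U (above x)) (not⁺ U⊈S)) c
    where
    nonzero : T (isNonzero U)
    nonzero with all-or-counterexample (_∈ˢ S) (members U)
    ... | inj₁ k = ⊥-elim (U⊈S (all-∈⁺ _ (members U) k))
    ... | inj₂ (v , v∈ , v∉S) = any-∈⁺ _ (members U) v v∈ (not⁺ λ v≡0 → v∉S (subst (T ∘ ⟪ S ⟫) (sym (≡ᵛ⁻ v≡0)) (zero∈ s)))

  𝟎 : ∀ {n} → Subset n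
  𝟎 = fromPred (_≡ᵛ 0ᵥ)

  𝟎-size : ∀ {n} → size ⟪ 𝟎 {n} ⟫ ≡ 1
  𝟎-size {n} = trans (fromPred-size {n} (_≡ᵛ 0ᵥ)) (zero-size {n})

  𝟎-isotropicSubspace : ∀ {n} {B : Form n} → IsBilinear B → IsotropicSubspace B 𝟎
  𝟎-isotropicSubspace {B = B} bil = fromPred-sub zero-sub , fromPred-isotropic λ u v hu hv →
    trans (cong (λ z → B z v) (trans (≡ᵛ⁻ hu) (sym (·ᵥ-zeroˡ u)))) (trans (IsBilinear.smulˡ bil 0# u v) (zeroˡ _))

  -- `strictChain` says nothing about what lies below the first member; being a nonzero subspace is
  -- what puts that member strictly above `𝟎`.
  weightedFlag⇒flag : ∀ {n} {B : Form n} fl → T (isWeightedFlag B fl) → Flag B 𝟎 fl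
  weightedFlag⇒flag [] _ = _
  weightedFlag⇒flag {B = B} ((U , w) ∷ fl) h = flag⁻ ((U , w) ∷ fl) h (∧⁺ (∧⁺ (⊆ˢ⁺ 𝟎 U 𝟎⊆U) (not⁺ U⊈𝟎)) (proj₂ (∧⁻ h)))
    where
    good = ∧⁻ {isSubspace U} (proj₁ (∧⁻ (proj₁ (∧⁻ (proj₁ (∧⁻ h))))))
    𝟎⊆U : ∀ v → T (v ∈ˢ 𝟎) → T (v ∈ˢ U)
    𝟎⊆U v t = subst (T ∘ ⟪ U ⟫) (sym (≡ᵛ⁻ (subst T (∈-fromPred (_≡ᵛ 0ᵥ) v) t))) (zero∈ (isSubspace⁻ U (proj₁ good)))
    U⊈𝟎 : ¬ T (U ⊆ˢ 𝟎)
    U⊈𝟎 t with any-∈⁻ _ (members U) (proj₂ (∧⁻ {isIsotropic B U} (proj₂ good)))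
    ... | v , v∈ , v≢0 = not⁻ v≢0 (subst T (∈-fromPred (_≡ᵛ 0ᵥ) v) (⊆ˢ⁻ U 𝟎 t v (∈ˢ⁺ U v∈)))

  module _ {n n′} {B : Form n} {B′ : Form n′} {K} (bal : Balanced B K) (bal′ : Balanced B′ K) (m : ℕ) where

    WF-correct : (F : WF B m) →
      T (isWeightedFlag B′ (transport B B′ 𝟎 𝟎 (proj₁ F)) ∧ (weight (transport B B′ 𝟎 𝟎 (proj₁ F)) ≡ᵇ m)) ×
      transport B′ B 𝟎 𝟎 (transport B B′ 𝟎 𝟎 (proj₁ F)) ≡ proj₁ F
    WF-correct (fl , h) =
      let wf , wt = ∧⁻ h
          g′ = 𝟎-isotropicSubspace (Balanced.bil bal′)
          h′ , wt′ , inv = Transport.transport-correct bal bal′ (𝟎-isotropicSubspace (Balanced.bil bal)) g′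
                             (trans (𝟎-size {n}) (sym (𝟎-size {n′}))) fl (weightedFlag⇒flag fl wf)
      in ∧⁺ (proj₁ (flag⁺ (subspace g′) _ h′)) (≡⇒≡ᵇ _ m (trans wt′ (≡ᵇ⇒≡ _ m wt))) , inv

    WF-map : WF B m → WF B′ m
    WF-map F = transport B B′ 𝟎 𝟎 (proj₁ F) , proj₁ (WF-correct F)

  WF-≡ : ∀ {n} {B : Form n} {m} {F G : WF B m} → proj₁ F ≡ proj₁ G → F ≡ G
  WF-≡ {F = fl , h} {G = .fl , h′} refl = cong (fl ,_) (T-irrelevant h h′)

  balanced⇒WF↔ : ∀ {n n′} {B : Form n} {B′ : Form n′} {K} → Balanced B K → Balanced B′ K → ∀ m → WF B m ↔ WF B′ m
  balanced⇒WF↔ bal bal′ m = mk↔ₛ′ (WF-map bal bal′ m) (WF-map bal′ bal m)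
    (λ G → WF-≡ (proj₂ (WF-correct bal′ bal m G))) (λ F → WF-≡ (proj₂ (WF-correct bal bal′ m F)))

  polar-symmetric : ∀ {n} (Q : Vect n → Carrier) u v → polar Q u v ≡ polar Q v u
  polar-symmetric Q u v = cong₂ _⊕_ (cong Q (+ᵥ-comm u v)) (⊕-comm _ _)

theorem3p3 : (𝔽 : FiniteField) → ¬ (2 ∣ FiniteField.order 𝔽) → (d : ℕ)
    → (ω : Over.Form 𝔽 (2 * d)) → Over.IsSymplectic 𝔽 ω
    → (Q : Over.Vect 𝔽 (2 * d + 1) → FiniteField.Carrier 𝔽)
    → Over.IsNondegQuadratic 𝔽 Q → Over.HasTotIsotropic 𝔽 Q d
    → (m : ℕ) → Over.WF 𝔽 ω m ↔ Over.WF 𝔽 (Over.polar 𝔽 Q) m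
theorem3p3 𝔽 odd d ω sp Q qd (L , h) =
  -- Both balance constants are `q ^ (2 * d)`, so a single `K` serves the two forms; `refl`
  -- identifies the ambient dimension as `2 * d + 1`.
  balanced⇒WF↔ (symplectic-balanced sp) (orthogonal-balanced {d} refl sL (isIsotropic⁻ L isoL)
    (trans (size≡q^dim L sL) (cong (q ^_) (≡ᵇ⇒≡ (dim L) d dimL))))
  where
  open Over 𝔽
  open Geometry 𝔽
  open IsNondegQuadratic qd
  open Orthogonal polarBilinear (polar-symmetric Q) nondeg (odd-order⇒1+1≢0 odd)
  rest = proj₂ (∧⁻ {isSubspace L} h)
  sL = isSubspace⁻ L (proj₁ (∧⁻ h))
  isoL = proj₁ (∧⁻ rest)
  dimL = proj₂ (∧⁻ {isIsotropic (polar Q) L} rest)
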